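{- A partition $\lambda$ has no diagonal blocks (i.e. $\kappa(\lambda)=0$) if and only if it is self-conjugate. Consequently, for every $n\ge 0$, if $E(n)$ and $O(n)$ denote the numbers of partitions of $n$ having even and odd pairing rank, respectively, then $$E(n)-O(n)=(-1)^n\,\#\{\lambda\vdash n:\kappa(\lambda)=0\}.$$
   Context: Diagonal blocks: let $\lambda$ be a partition with conjugate $\lambda'$ and Durfee size $d$ (the side of the largest square contained in the Young diagram of $\lambda$). Put $\alpha_i=\lambda_i-d$, $\beta_i=\lambda_i'-d$, $I_i=\min(\alpha_i,\beta_i)$ and $U_i=\max(\alpha_i,\beta_i)$ for $1\le i\le d$. The diagonal blocks of $\lambda$ are the edge-connected components of the skew diagram $U/I$ (cells adjacent when they share an edge), and $\kappa(\lambda)$ is their number. Pairing rank: for a partition $\lambda$, let $r(\lambda)$ be the largest part size of multiplicity at least $2$ ($r(\lambda)=0$ if $\lambda$ has distinct parts). Let $u_1>u_2>\cdots$ be the part sizes occurring with odd multiplicity, each taken once, and let $s(\lambda)=u_1-u_2+u_3-u_4+\cdots$ ($0$ if there are none). The pairing rank is $\rho(\lambda)=r(\lambda)-s(\lambda)$. -}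

module Defs where

open import Data.Integer as ℤ using (ℤ; 0ℤ; +_; ∣_∣)
import Data.Integer.Divisibility as ℤ∣
open import Data.List.Base
  using (List; []; _∷_; length; map; filter; upTo; concatMap; deduplicate; mapMaybe; cartesianProductWith)
open import Data.List.Extrema.Nat using (max)
open import Data.List.Membership.Propositional using (_∈_)
import Data.List.Membership.DecPropositional as DecMembership
open import Data.List.Membership.Propositional.Properties
  using (∈-map⁺; ∈-map⁻; ∈-filter⁺; ∈-filter⁻; ∈-upTo⁺; ∈-cartesianProductWith⁺)
open import Data.List.Properties using (filter-accept; filter-reject; filter-some; ∷-injective)
open import Data.List.Relation.Binary.Sublist.Propositional using (⊆-refl)
open import Data.List.Relation.Binary.Sublist.Heterogeneous.Properties
  using (length-mono-≤; ⊆-filter-Sublist)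
open import Data.List.Relation.Unary.All as All using (All; []; _∷_)
import Data.List.Relation.Unary.All.Properties as All
open import Data.List.Relation.Unary.Any using (here; there)
open import Data.List.Relation.Unary.Linked as Linked using (Linked; [-]; linked?)
import Data.List.Relation.Unary.Linked.Properties as Linked
open import Data.List.Relation.Unary.Unique.Propositional using (Unique; []; _∷_)
import Data.List.Relation.Unary.Unique.Propositional.Properties as Unique
open import Data.Maybe.Base using (Maybe; just; nothing)
open import Data.Nat.Base
  using (ℕ; zero; suc; _+_; _∸_; _≤_; _≥_; _<_; _⊔_; _⊓_; ∣_-_∣; z≤n; s≤s)
open import Data.Nat.Divisibility using (_∣_; _∣?_)
open import Data.Nat.ListAction using (sum)
open import Data.Nat.Properties
open import Data.Product.Base using (∃; _×_; _,_; proj₁; proj₂)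
open import Data.Product.Properties using (≡-dec)
open import Data.Sum.Base using (_⊎_; inj₁; inj₂)
open import Function.Base using (_∘_; id)
open import Relation.Binary.Construct.Closure.ReflexiveTransitive using (Star; ε; _◅_; _◅◅_)
open import Relation.Binary.Definitions using (DecidableEquality) renaming (Decidable to Decidable₂)
open import Relation.Binary.PropositionalEquality
open import Relation.Nullary.Decidable using (Dec; yes; no; map′; ¬?; _×-dec_; _⊎-dec_)
open import Relation.Nullary.Negation using (¬_)
open import Relation.Unary using (Pred; Decidable)
open import Level using (0ℓ)

------------------------------------------------------------------------
-- Partitions

record Partition : Set where
  constructor partition
  field
    parts      : List ℕ
    decreasing : Linked _≥_ parts
    positive   : All (1 ≤_) parts

open Partition public

-- The two proof fields are propositions, so partitions are equal as soon
-- as their parts are.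
parts-injective : ∀ {μ ν} → parts μ ≡ parts ν → μ ≡ ν
parts-injective {partition _ d p} {partition _ e q} refl =
  cong₂ (partition _) (Linked.irrelevant ≤-irrelevant d e) (All.irrelevant ≤-irrelevant p q)

infix 4 _⊢_
_⊢_ : Partition → ℕ → Set
μ ⊢ n = sum (parts μ) ≡ n

-- Rows, columns and parts are numbered from 0; parts beyond the last are 0.
nth : List ℕ → ℕ → ℕ
nth []       _       = 0
nth (x ∷ xs) zero    = x
nth (x ∷ xs) (suc i) = nth xs i

part : Partition → ℕ → ℕ
part μ = nth (parts μ)

-- Column j consists of one cell for each part exceeding j.
columnLength : List ℕ → ℕ → ℕ
columnLength xs j = length (filter (j <?_) xs)

conjugate : Partition → Partition
conjugate μ = partition
  (map (columnLength (parts μ)) (upTo (part μ 0)))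
  (Linked.map⁺ (Linked.applyUpTo⁺₂ id (part μ 0) shrink))
  (All.map⁺ (All.applyUpTo⁺₁ id (part μ 0) (nonempty (parts μ))))
  where
  shrink : ∀ j → columnLength (parts μ) j ≥ columnLength (parts μ) (suc j)
  shrink j = length-mono-≤
    (⊆-filter-Sublist (suc j <?_) (j <?_) (λ { refl → <-trans (n<1+n j) }) (⊆-refl {x = parts μ}))

  nonempty : ∀ xs {j} → j < nth xs 0 → 1 ≤ columnLength xs j
  nonempty (x ∷ xs) {j} j<x = filter-some (j <?_) (here j<x)

SquareFits : Partition → ℕ → Set
SquareFits μ d = ∀ {i} → i < d → ∀ {j} → j < d → j < part μ i

squareFits? : ∀ μ → Decidable (SquareFits μ)
squareFits? μ d = allUpTo? (λ i → allUpTo? (λ j → j <? part μ i) d) d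

durfee : Partition → ℕ
durfee μ = max 0 (filter (squareFits? μ) (upTo (suc (length (parts μ)))))

------------------------------------------------------------------------
-- Reachability along a relation whose targets lie in a finite list is
-- decidable: Path vs x y allows only members of vs as intermediate points.

module _ {A : Set} {R : A → A → Set} where

  Path : List A → A → A → Set
  Path []       x y = x ≡ y ⊎ R x y
  Path (v ∷ vs) x y = Path vs x y ⊎ (Path vs x v × Path vs v y)

  path? : DecidableEquality A → Decidable₂ R → ∀ vs → Decidable₂ (Path vs)
  path? _≟ᴬ_ R? []       x y = (x ≟ᴬ y) ⊎-dec R? x y
  path? _≟ᴬ_ R? (v ∷ vs) x y =
    path? _≟ᴬ_ R? vs x y ⊎-dec (path? _≟ᴬ_ R? vs x v ×-dec path? _≟ᴬ_ R? vs v y)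

  path⇒star : ∀ vs {x y} → Path vs x y → Star R x y
  path⇒star []       (inj₁ refl)    = ε
  path⇒star []       (inj₂ r)       = r ◅ ε
  path⇒star (v ∷ vs) (inj₁ p)       = path⇒star vs p
  path⇒star (v ∷ vs) (inj₂ (p , q)) = path⇒star vs p ◅◅ path⇒star vs q

  path-base : ∀ vs {x y} → x ≡ y ⊎ R x y → Path vs x y
  path-base []       p = p
  path-base (v ∷ vs) p = inj₁ (path-base vs p)

  path-join : ∀ vs {x w y} → w ∈ vs → Path vs x w → Path vs w y → Path vs x y
  path-join (v ∷ vs) (here refl) p q = inj₂ (toV p , fromV q)
    where
    toV : ∀ {x} → Path (v ∷ vs) x v → Path vs x v
    toV (inj₁ p)       = p
    toV (inj₂ (p , _)) = p
    fromV : ∀ {y} → Path (v ∷ vs) v y → Path vs v y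
    fromV (inj₁ q)       = q
    fromV (inj₂ (_ , q)) = q
  path-join (v ∷ vs) (there w∈) (inj₁ p)        (inj₁ q)        = inj₁ (path-join vs w∈ p q)
  path-join (v ∷ vs) (there w∈) (inj₁ p)        (inj₂ (q , q′)) = inj₂ (path-join vs w∈ p q , q′)
  path-join (v ∷ vs) (there w∈) (inj₂ (p , p′)) (inj₁ q)        = inj₂ (p , path-join vs w∈ p′ q)
  path-join (v ∷ vs) (there w∈) (inj₂ (p , _))  (inj₂ (_ , q′)) = inj₂ (p , q′)

  star? : DecidableEquality A → Decidable₂ R →
          (vs : List A) → (∀ {x y} → R x y → y ∈ vs) → Decidable₂ (Star R)
  star? _≟ᴬ_ R? vs target x y = map′ (path⇒star vs) star⇒path (path? _≟ᴬ_ R? vs x y)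
    where
    star⇒path : ∀ {x y} → Star R x y → Path vs x y
    star⇒path ε        = path-base vs (inj₁ refl)
    star⇒path (r ◅ rs) = path-join vs (target r) (path-base vs (inj₂ r)) (star⇒path rs)

------------------------------------------------------------------------
-- Diagonal blocks

Cell : Set
Cell = ℕ × ℕ

_≟ᶜ_ : DecidableEquality Cell
_≟ᶜ_ = ≡-dec _≟_ _≟_

Adjacent : Cell → Cell → Set
Adjacent (i , j) (i′ , j′) = (i ≡ i′ × ∣ j - j′ ∣ ≡ 1) ⊎ (∣ i - i′ ∣ ≡ 1 × j ≡ j′)

adjacent? : Decidable₂ Adjacent
adjacent? (i , j) (i′ , j′) =
  ((i ≟ i′) ×-dec (∣ j - j′ ∣ ≟ 1)) ⊎-dec ((∣ i - i′ ∣ ≟ 1) ×-dec (j ≟ j′))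

AdjacentIn : List Cell → Cell → Cell → Set
AdjacentIn S c c′ = c ∈ S × c′ ∈ S × Adjacent c c′

-- AdjacentIn S is symmetric, so this is an equivalence relation.
Connected : List Cell → Cell → Cell → Set
Connected S = Star (AdjacentIn S)

connected? : ∀ S → Decidable₂ (Connected S)
connected? S = star? _≟ᶜ_ (λ c c′ → (c ∈? S) ×-dec ((c′ ∈? S) ×-dec adjacent? c c′))
                     S (proj₁ ∘ proj₂)
  where open DecMembership _≟ᶜ_ using (_∈?_)

-- Deduplicating up to connectedness keeps one cell of each component.
#components : List Cell → ℕ
#components S = length (deduplicate (connected? S) S)

-- The rows i < durfee μ, the only ones used below, and the corresponding
-- columns have length at least durfee μ, so the subtractions do not truncate.
α β I U : Partition → ℕ → ℕ
α μ i = part μ i ∸ durfee μ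
β μ i = part (conjugate μ) i ∸ durfee μ
I μ i = α μ i ⊓ β μ i
U μ i = α μ i ⊔ β μ i

-- The cells (i , j) with i < durfee μ and I μ i ≤ j < U μ i.
U/I : Partition → List Cell
U/I μ = concatMap (λ i → map (i ,_) (filter (I μ i ≤?_) (upTo (U μ i)))) (upTo (durfee μ))

κ : Partition → ℕ
κ μ = #components (U/I μ)

------------------------------------------------------------------------
-- Pairing rank

multiplicity : Partition → ℕ → ℕ
multiplicity μ p = length (filter (p ≟_) (parts μ))

r : Partition → ℕ
r μ = max 0 (filter (λ p → 2 ≤? multiplicity μ p) (parts μ))

-- In decreasing order, because parts μ is.
oddMultiplicityParts : Partition → List ℕ
oddMultiplicityParts μ =
  filter (λ p → ¬? (2 ∣? multiplicity μ p)) (deduplicate _≟_ (parts μ))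

alternatingSum : List ℕ → ℤ
alternatingSum []       = 0ℤ
alternatingSum (u ∷ us) = + u ℤ.- alternatingSum us

s : Partition → ℤ
s μ = alternatingSum (oddMultiplicityParts μ)

ρ : Partition → ℤ
ρ μ = + r μ ℤ.- s μ

Even Odd : ℤ → Set
Even z = + 2 ℤ∣.∣ z
Odd  z = ¬ Even z

even? : Decidable Even
even? z = 2 ∣? ∣ z ∣

odd? : Decidable Odd
odd? z = ¬? (even? z)

------------------------------------------------------------------------
-- Counting partitions of n

words : List ℕ → ℕ → List (List ℕ)
words as zero    = [] ∷ []
words as (suc ℓ) = [] ∷ cartesianProductWith _∷_ as (words as ℓ)

IsPartition : List ℕ → Set
IsPartition xs = Linked _≥_ xs × All (1 ≤_) xs

isPartition? : Decidable IsPartition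
isPartition? xs = linked? _≥?_ xs ×-dec All.all? (1 ≤?_) xs

toPartition : List ℕ → Maybe Partition
toPartition xs with isPartition? xs
... | yes (d , p) = just (partition xs d p)
... | no _        = nothing

-- A partition of n has at most n parts, all of them at most n, so it is
-- found among the words of length at most n in the letters 0, …, n.
candidates : ℕ → List Partition
candidates n = mapMaybe toPartition (words (upTo (suc n)) n)

partitions : ℕ → List Partition
partitions n = filter (λ μ → sum (parts μ) ≟ n) (candidates n)

count : {P : Pred Partition 0ℓ} → Decidable P → ℕ → ℕ
count P? n = length (filter P? (partitions n))

E O : ℕ → ℕ
E = count (even? ∘ ρ)
O = count (odd? ∘ ρ)

-- partitions n lists every partition of n exactly once.

parts-mapMaybe : ∀ xss → map parts (mapMaybe toPartition xss) ≡ filter isPartition? xss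
parts-mapMaybe []         = refl
parts-mapMaybe (xs ∷ xss) with isPartition? xs
... | yes p = trans (cong (xs ∷_) (parts-mapMaybe xss)) (sym (filter-accept isPartition? p))
... | no ¬p = trans (parts-mapMaybe xss) (sym (filter-reject isPartition? ¬p))

words-complete : ∀ {as} ℓ {xs} → All (_∈ as) xs → length xs ≤ ℓ → xs ∈ words as ℓ
words-complete zero    []         _       = here refl
words-complete (suc ℓ) []         _       = here refl
words-complete (suc ℓ) (x∈ ∷ xs∈) (s≤s h) =
  there (∈-cartesianProductWith⁺ _∷_ x∈ (words-complete ℓ xs∈ h))

words-unique : ∀ {as} → Unique as → ∀ ℓ → Unique (words as ℓ)
words-unique !as zero    = [] ∷ []
words-unique {as} !as (suc ℓ) =
  nonnil as ∷ Unique.cartesianProductWith⁺ _∷_ ∷-injective !as (words-unique !as ℓ)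
  where
  nonnil : ∀ bs → All ([] ≢_) (cartesianProductWith _∷_ bs (words as ℓ))
  nonnil []       = []
  nonnil (b ∷ bs) = All.++⁺ (All.map⁺ (All.universal (λ _ ()) (words as ℓ))) (nonnil bs)

length≤sum : ∀ {xs} → All (1 ≤_) xs → length xs ≤ sum xs
length≤sum []       = z≤n
length≤sum (p ∷ ps) = +-mono-≤ p (length≤sum ps)

entries≤sum : ∀ xs → All (_≤ sum xs) xs
entries≤sum []       = []
entries≤sum (x ∷ xs) =
  m≤m+n x (sum xs) ∷ All.map (λ y≤ → ≤-trans y≤ (m≤n+m (sum xs) x)) (entries≤sum xs)

candidates-parts : ∀ n →
  map parts (candidates n) ≡ filter isPartition? (words (upTo (suc n)) n)
candidates-parts n = parts-mapMaybe (words (upTo (suc n)) n)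

candidates-complete : ∀ μ → μ ∈ candidates (sum (parts μ))
candidates-complete μ = recover (∈-map⁻ parts parts∈)
  where
  n  = sum (parts μ)
  ws = words (upTo (suc n)) n

  parts∈ws : parts μ ∈ ws
  parts∈ws = words-complete n
    (All.map (λ x≤n → ∈-upTo⁺ (s≤s x≤n)) (entries≤sum (parts μ))) (length≤sum (positive μ))

  parts∈ : parts μ ∈ map parts (candidates n)
  parts∈ = subst (parts μ ∈_) (sym (candidates-parts n))
    (∈-filter⁺ isPartition? parts∈ws (decreasing μ , positive μ))

  recover : ∃ (λ ν → ν ∈ candidates n × parts μ ≡ parts ν) → μ ∈ candidates n
  recover (ν , ν∈ , eq) = subst (_∈ candidates n) (parts-injective (sym eq)) ν∈

partitions-sound : ∀ n {μ} → μ ∈ partitions n → μ ⊢ n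
partitions-sound n μ∈ = proj₂ (∈-filter⁻ (λ ν → sum (parts ν) ≟ n) {xs = candidates n} μ∈)

partitions-complete : ∀ n {μ} → μ ⊢ n → μ ∈ partitions n
partitions-complete n {μ} refl =
  ∈-filter⁺ (λ ν → sum (parts ν) ≟ n) (candidates-complete μ) refl

partitions-unique : ∀ n → Unique (partitions n)
partitions-unique n = Unique.filter⁺ (λ μ → sum (parts μ) ≟ n)
  (Unique.map⁻ {f = parts} (subst Unique (sym (candidates-parts n))
    (Unique.filter⁺ isPartition? (words-unique (Unique.upTo⁺ (suc n)) n))))

{-# OPTIONS --safe #-}
module Submission where

open import Defs
open import Data.Integer as ℤ using (ℤ; 0ℤ; 1ℤ; +_; _-_; _*_; _^_; -1ℤ; ∣_∣)
import Data.Integer.Properties as ℤ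
open import Data.Integer.Tactic.RingSolver using (solve-∀)
open import Data.List.Base hiding (partition; sum)
import Data.List.Extrema.Nat as Extrema
open import Data.List.Membership.Propositional using (_∈_)
open import Data.List.Membership.Propositional.Properties
open import Data.List.Membership.Propositional.Properties.WithK using (unique∧set⇒bag)
open import Data.List.Properties
open import Data.List.Relation.Binary.BagAndSetEquality using (∼bag⇒↭)
open import Data.List.Relation.Binary.Permutation.Propositional using (_↭_; ↭⇒↭ₛ)
open import Data.List.Relation.Binary.Permutation.Propositional.Properties
  using (↭-length) renaming (map⁺ to ↭-map⁺)
open import Data.List.Relation.Binary.Permutation.Setoid.Properties
  using (foldr-commMonoid)
open import Data.List.Relation.Unary.All as All using (All; []; _∷_)
open import Data.List.Relation.Unary.All.Properties using (all-filter)
open import Data.List.Relation.Unary.Any using (here; there)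
open import Data.List.Relation.Unary.Linked as Linked using (Linked; []; [-]; _∷_)
open import Data.List.Relation.Unary.Unique.Propositional using (Unique; []; _∷_)
import Data.List.Relation.Unary.Unique.Propositional.Properties as Unique
open import Data.Nat
  using (ℕ; zero; suc; _+_; _∸_; _≟_; _≤?_; _<?_; _≤_; _<_; _≥_; _>_; _⊔_; _⊓_; s≤s; z≤n; ⌊_/2⌋)
import Data.Nat as ℕ
open import Data.List.Relation.Unary.Unique.DecPropositional.Properties _≟_ using (deduplicate-!)
open import Data.Nat.Divisibility using (_∣_; _∣?_; divides; ∣m+n∣m⇒∣n; ∣⇒≤; ∣m⇒∣m*n)
open import Data.Nat.ListAction using (sum)
open import Data.Nat.Properties
open import Data.Nat.Tactic.RingSolver using () renaming (solve-∀ to ℕ-solve-∀)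
open import Data.Product using (_×_; _,_; ∃; proj₁; proj₂; map₁; map₂)
open import Data.Product.Properties using (,-injective)
open import Data.Sum using (_⊎_; inj₁; inj₂)
open import Function.Base using (_∘_; id; _⟨_⟩_)
open import Function.Bundles using (_⇔_; mk⇔)
open import Relation.Binary.Definitions using (tri<; tri≈; tri>)
open import Relation.Binary.PropositionalEquality
open import Relation.Nullary using (Dec; yes; no; ¬_; contradiction; ¬?)
open import Relation.Nullary.Decidable using (decidable-stable; _×-dec_)
open import Relation.Unary using (Pred; Decidable)

-- Write a partition λ uniquely as μ ∪ ν ∪ ν with μ strict: every part of multiplicity m
-- contributes m mod 2 copies to μ and ⌊m/2⌋ copies to ν. Then r(λ) is the largest part of ν,
-- while s(λ) has the parity of |λ|, so that E(n) − O(n) is (−1)ⁿ times the sum of (−1)^{ν₁}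
-- over the pairs (μ , ν) with |μ| + 2|ν| = n. Conjugating ν turns the sign into (−1)^{ℓ(ν)}.
-- Let 2p be the largest number that is an even part of μ or twice a part of ν; exchanging the
-- part 2p of μ for a part p of ν, or conversely, is a sign-reversing involution whose fixed
-- points are the strict partitions μ into odd parts, with ν empty. These are the diagonal hook
-- lengths of the self-conjugate partitions, which are exactly those without diagonal blocks.

-- Sums over finite lists

∑ : {A : Set} → (A → ℤ) → List A → ℤ
∑ w xs = foldr ℤ._+_ 0ℤ (map w xs)

∑-↭ : {A : Set} (w : A → ℤ) {xs ys : List A} → xs ↭ ys → ∑ w xs ≡ ∑ w ys
∑-↭ w p = foldr-commMonoid (setoid ℤ) ℤ.+-0-isCommutativeMonoid (↭⇒↭ₛ (↭-map⁺ w p))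

∑-map : {A B : Set} (w : B → ℤ) (f : A → B) (xs : List A) → ∑ w (map f xs) ≡ ∑ (w ∘ f) xs
∑-map w f xs = cong (foldr ℤ._+_ 0ℤ) (sym (map-∘ xs))

∑-cong : {A : Set} {v w : A → ℤ} (xs : List A) →
         (∀ {x} → x ∈ xs → v x ≡ w x) → ∑ v xs ≡ ∑ w xs
∑-cong []       h = refl
∑-cong (x ∷ xs) h = cong₂ ℤ._+_ (h (here refl)) (∑-cong xs (h ∘ there))

interchange : ∀ a b c d → (a ℤ.+ b) ℤ.+ (c ℤ.+ d) ≡ (a ℤ.+ c) ℤ.+ (b ℤ.+ d)
interchange = solve-∀

∑-+ : {A : Set} (v w : A → ℤ) (xs : List A) → ∑ v xs ℤ.+ ∑ w xs ≡ ∑ (λ x → v x ℤ.+ w x) xs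
∑-+ v w []       = refl
∑-+ v w (x ∷ xs) =
  trans (interchange (v x) (∑ v xs) (w x) (∑ w xs)) (cong (ℤ._+_ (v x ℤ.+ w x)) (∑-+ v w xs))

∑-*ˡ : {A : Set} (k : ℤ) (w : A → ℤ) (xs : List A) → ∑ (λ x → k * w x) xs ≡ k * ∑ w xs
∑-*ˡ k w []       = sym (ℤ.*-zeroʳ k)
∑-*ˡ k w (x ∷ xs) =
  trans (cong (ℤ._+_ (k * w x)) (∑-*ˡ k w xs)) (sym (ℤ.*-distribˡ-+ k (w x) (∑ w xs)))

indicator : {P : Set} → Dec P → ℤ
indicator (yes _) = 1ℤ
indicator (no _)  = 0ℤ

∑-indicator : {A : Set} {P : Pred A _} (P? : Decidable P) (xs : List A) →
              ∑ (indicator ∘ P?) xs ≡ + length (filter P? xs)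
∑-indicator P? []       = refl
∑-indicator P? (x ∷ xs) with P? x
... | yes _ = cong (ℤ._+_ 1ℤ) (∑-indicator P? xs)
... | no  _ = trans (ℤ.+-identityˡ _) (∑-indicator P? xs)

-- Injectivity is asked only on members of the list: `hooks ∘ proj₁`, for one, is injective on rigid
-- pairs but not on all pairs.
Unique-map : {A B : Set} (f : A → B) {xs : List A} → Unique xs →
             (∀ {x y} → x ∈ xs → y ∈ xs → f x ≡ f y → x ≡ y) → Unique (map f xs)
Unique-map f []                inj = []
Unique-map f {x ∷ xs} (x∉ ∷ !xs) inj =
  All.tabulate distinct ∷ Unique-map f !xs (λ y∈ z∈ → inj (there y∈) (there z∈))
  where
  distinct : ∀ {b} → b ∈ map f xs → f x ≢ b
  distinct b∈ refl with ∈-map⁻ f b∈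
  ... | y , y∈ , fx≡fy = All.lookup x∉ y∈ (inj (here refl) (there y∈) fx≡fy)

-- Lists without repetition that have the same members are equal as bags, hence permutations of each
-- other. In this way a bijection becomes an equality of sums or of lengths.
map-↭ : {A B : Set} (f : A → B) {xs : List A} {ys : List B} → Unique xs → Unique ys →
        (∀ {x} → x ∈ xs → f x ∈ ys) →
        (∀ {x x′} → x ∈ xs → x′ ∈ xs → f x ≡ f x′ → x ≡ x′) →
        (∀ {y} → y ∈ ys → ∃ λ x → x ∈ xs × f x ≡ y) →
        map f xs ↭ ys
map-↭ f {xs} {ys} !xs !ys into inj onto =
  ∼bag⇒↭ (unique∧set⇒bag (Unique-map f !xs inj) !ys (mk⇔ to from))
  where
  to : ∀ {y} → y ∈ map f xs → y ∈ ys
  to y∈ with ∈-map⁻ f y∈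
  ... | x , x∈ , refl = into x∈
  from : ∀ {y} → y ∈ ys → y ∈ map f xs
  from y∈ with onto y∈
  ... | x , x∈ , refl = ∈-map⁺ f x∈

∑-involution : {A : Set} (w : A → ℤ) (f : A → A) {xs : List A} → Unique xs →
               (∀ {x} → x ∈ xs → f x ∈ xs) → (∀ {x} → x ∈ xs → f (f x) ≡ x) →
               ∑ (w ∘ f) xs ≡ ∑ w xs
∑-involution w f {xs} !xs into inv = trans (sym (∑-map w f xs)) (∑-↭ w
  (map-↭ f !xs !xs into
    (λ x∈ y∈ eq → trans (sym (inv x∈)) (trans (cong f eq) (inv y∈)))
    (λ y∈ → f _ , into y∈ , inv y∈)))

double : ∀ i → i ℤ.+ i ≡ + 2 * i
double = solve-∀

-- Reindexing along `f` preserves the sum, so twice the sum adds each term to that of its partner;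
-- the factor 2 then cancels in ℤ. Fixed points and cancelling pairs are thus handled together,
-- through `v`.
∑-signReversing : {A : Set} (w v : A → ℤ) (f : A → A) {xs : List A} → Unique xs →
                  (∀ {x} → x ∈ xs → f x ∈ xs) → (∀ {x} → x ∈ xs → f (f x) ≡ x) →
                  (∀ {x} → x ∈ xs → w x ℤ.+ w (f x) ≡ + 2 * v x) →
                  ∑ w xs ≡ ∑ v xs
∑-signReversing w v f {xs} !xs into inv cancel = ℤ.*-cancelˡ-≡ (+ 2) _ _ (begin
  + 2 * ∑ w xs                     ≡⟨ double (∑ w xs) ⟨
  ∑ w xs ℤ.+ ∑ w xs                ≡⟨ cong (ℤ._+_ (∑ w xs)) (∑-involution w f !xs into inv) ⟨
  ∑ w xs ℤ.+ ∑ (w ∘ f) xs          ≡⟨ ∑-+ w (w ∘ f) xs ⟩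
  ∑ (λ x → w x ℤ.+ w (f x)) xs     ≡⟨ ∑-cong xs cancel ⟩
  ∑ (λ x → + 2 * v x) xs           ≡⟨ ∑-*ˡ (+ 2) v xs ⟩
  + 2 * ∑ v xs                     ∎)
  where open ≡-Reasoning

-- Signs

sign : ℕ → ℤ
sign n = -1ℤ ^ n

sign-+ : ∀ m n → sign (m + n) ≡ sign m * sign n
sign-+ = ℤ.^-distribˡ-+-* -1ℤ

sign-suc : ∀ n → sign (suc n) ≡ ℤ.- sign n
sign-suc n = ℤ.-1*i≡-i (sign n)

sign-cancel : ∀ n → sign n * sign n ≡ 1ℤ
sign-cancel zero    = refl
sign-cancel (suc n) = trans (square (sign n)) (sign-cancel n)
  where
  square : ∀ i → (-1ℤ * i) * (-1ℤ * i) ≡ i * i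
  square = solve-∀

sign-+-self : ∀ m n → sign (m + (n + n)) ≡ sign m
sign-+-self m n = trans (sign-+ m (n + n)) (trans
  (cong (sign m *_) (trans (sign-+ n n) (sign-cancel n))) (ℤ.*-identityʳ (sign m)))

-- Lowering both `m` and `n` by 1 keeps the difference and changes both signs on the right, which
-- reduces everything to the case where one of them is 0.
sign-⊖ : ∀ m n → sign ∣ m ℤ.⊖ n ∣ ≡ sign m * sign n
sign-⊖ zero    zero    = refl
sign-⊖ zero    (suc n) = sym (ℤ.*-identityˡ _)
sign-⊖ (suc m) zero    = sym (ℤ.*-identityʳ _)
sign-⊖ (suc m) (suc n) = trans (cong (sign ∘ ∣_∣) (ℤ.[1+m]⊖[1+n]≡m⊖n m n))
  (trans (sign-⊖ m n) (sym (signs (sign m) (sign n))))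
  where
  signs : ∀ i j → (-1ℤ * i) * (-1ℤ * j) ≡ i * j
  signs = solve-∀

sign-∣-∣ : ∀ m j → sign ∣ + m - j ∣ ≡ sign m * sign ∣ j ∣
sign-∣-∣ m (+ n)        = trans (cong (sign ∘ ∣_∣) (ℤ.m-n≡m⊖n m n)) (sign-⊖ m n)
sign-∣-∣ m (ℤ.-[1+ n ]) = sign-+ m (suc n)

-- Halves and parity

⌊/2⌋-cases : ∀ n → n ≡ ⌊ n /2⌋ + ⌊ n /2⌋ ⊎ n ≡ suc (⌊ n /2⌋ + ⌊ n /2⌋)
⌊/2⌋-cases zero          = inj₁ refl
⌊/2⌋-cases (suc zero)    = inj₂ refl
⌊/2⌋-cases (suc (suc n)) with ⌊/2⌋-cases n
... | inj₁ eq = inj₁ (cong suc (trans (cong suc eq) (sym (+-suc ⌊ n /2⌋ ⌊ n /2⌋))))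
... | inj₂ eq = inj₂ (cong (suc ∘ suc) (trans eq (sym (+-suc ⌊ n /2⌋ ⌊ n /2⌋))))

2∣n+n : ∀ n → 2 ∣ n + n
2∣n+n n = divides n (trans (cong (n ℕ.+_) (sym (+-identityʳ n))) (*-comm 2 n))

-- Removing the even summand `n + n` would leave `2 ∣ 1`, hence `2 ≤ 1`.
¬2∣1+n+n : ∀ n → ¬ 2 ∣ suc (n + n)
¬2∣1+n+n n 2∣ with s≤s () ← ∣⇒≤ (∣m+n∣m⇒∣n (subst (2 ∣_) (+-comm 1 (n + n)) 2∣) (2∣n+n n))

sign-even : ∀ {n} → 2 ∣ n → sign n ≡ 1ℤ
sign-even {n} 2∣n with ⌊/2⌋-cases n
... | inj₁ eq = trans (cong sign eq) (sign-+-self 0 ⌊ n /2⌋)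
... | inj₂ eq = contradiction (subst (2 ∣_) eq 2∣n) (¬2∣1+n+n ⌊ n /2⌋)

sign-odd : ∀ {n} → ¬ 2 ∣ n → sign n ≡ -1ℤ
sign-odd {n} 2∤n with ⌊/2⌋-cases n
... | inj₁ eq = contradiction (subst (2 ∣_) (sym eq) (2∣n+n ⌊ n /2⌋)) 2∤n
... | inj₂ eq = trans (cong sign eq) (sign-+-self 1 ⌊ n /2⌋)

-- To be used with `m` the absolute value of `ρ`, where the two complementary filters give `E` and
-- `O`.
even-odd-difference : {A : Set} (m : A → ℕ) (2∣m? : Decidable (λ x → 2 ∣ m x)) (xs : List A) →
  + length (filter 2∣m? xs) - + length (filter (¬? ∘ 2∣m?) xs) ≡ ∑ (sign ∘ m) xs
even-odd-difference m 2∣m? []       = refl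
even-odd-difference m 2∣m? (x ∷ xs) with 2∣m? x
... | yes 2∣ = trans (first (+ length (filter 2∣m? xs)) (+ length (filter (¬? ∘ 2∣m?) xs)))
                     (cong₂ ℤ._+_ (sym (sign-even 2∣)) (even-odd-difference m 2∣m? xs))
  where
  first : ∀ i j → (1ℤ ℤ.+ i) - j ≡ 1ℤ ℤ.+ (i - j)
  first = solve-∀
... | no 2∤ = trans (second (+ length (filter 2∣m? xs)) (+ length (filter (¬? ∘ 2∣m?) xs)))
                    (cong₂ ℤ._+_ (sym (sign-odd 2∤)) (even-odd-difference m 2∣m? xs))
  where
  second : ∀ i j → i - (1ℤ ℤ.+ j) ≡ -1ℤ ℤ.+ (i - j)
  second = solve-∀

-- The parity of s

-- Replacing subtraction by addition does not affect parity.
sign-alternatingSum : ∀ us → sign ∣ alternatingSum us ∣ ≡ sign (sum us)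
sign-alternatingSum []       = refl
sign-alternatingSum (u ∷ us) = trans (sign-∣-∣ u (alternatingSum us))
  (trans (cong (sign u *_) (sign-alternatingSum us)) (sym (sign-+ u (sum us))))

count≟ : ℕ → List ℕ → ℕ
count≟ p xs = length (filter (p ≟_) xs)

weighted : List ℕ → List ℕ → ℕ
weighted xs us = sum (map (λ p → count≟ p xs ℕ.* p) us)

weighted-∷-∉ : ∀ {x} xs {us} → All (x ≢_) us → weighted (x ∷ xs) us ≡ weighted xs us
weighted-∷-∉     xs []                     = refl
weighted-∷-∉ {x} xs (_∷_ {p} {us} x≢p x∉) = cong₂ _+_
  (cong (λ l → length l ℕ.* p) (filter-reject (p ≟_) {x} {xs} (x≢p ∘ sym)))
  (weighted-∷-∉ xs x∉)

-- As `us` has no repetition, exactly one summand changes: the multiplicity of `x` rises by one,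
-- which adds one `x`.
weighted-∷-∈ : ∀ {x} xs {us} → Unique us → x ∈ us → weighted (x ∷ xs) us ≡ x + weighted xs us
weighted-∷-∈ {x} xs {_ ∷ us} (x∉ ∷ _) (here refl) = trans (cong₂ _+_
  (cong (λ l → length l ℕ.* x) (filter-accept (x ≟_) {x} {xs} refl)) (weighted-∷-∉ xs x∉))
  (+-assoc x _ _)
weighted-∷-∈ {x} xs {p ∷ us} (p∉ ∷ !us) (there x∈) = begin
  count≟ p (x ∷ xs) ℕ.* p + weighted (x ∷ xs) us ≡⟨ cong₂ _+_ (cong (λ l → length l ℕ.* p)
    (filter-reject (p ≟_) {x} {xs} (All.lookup p∉ x∈))) (weighted-∷-∈ xs !us x∈) ⟩
  a + (x + b) ≡⟨ +-assoc a x b ⟨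
  (a + x) + b ≡⟨ cong (_+ b) (+-comm a x) ⟩
  (x + a) + b ≡⟨ +-assoc x a b ⟩
  x + (a + b) ∎
  where
  open ≡-Reasoning
  a = count≟ p xs ℕ.* p
  b = weighted xs us

weighted-sum : ∀ {us} → Unique us → ∀ xs → (∀ {x} → x ∈ xs → x ∈ us) → weighted xs us ≡ sum xs
weighted-sum {us} !us []       sub = zeros us
  where
  zeros : ∀ us → weighted [] us ≡ 0
  zeros []       = refl
  zeros (u ∷ us) = zeros us
weighted-sum !us (x ∷ xs) sub =
  trans (weighted-∷-∈ xs !us (sub (here refl))) (cong (x ℕ.+_) (weighted-sum !us xs (sub ∘ there)))

sign-*-even : ∀ {m} p → 2 ∣ m → sign (m ℕ.* p) ≡ 1ℤ
sign-*-even {m} p 2∣m = sign-even (∣m⇒∣m*n p 2∣m)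

sign-*-odd : ∀ {m} p → ¬ 2 ∣ m → sign (m ℕ.* p) ≡ sign p
sign-*-odd {m} p 2∤m with ⌊/2⌋-cases m
... | inj₁ eq = contradiction (subst (2 ∣_) (sym eq) (2∣n+n ⌊ m /2⌋)) 2∤m
... | inj₂ eq = trans (cong (λ m → sign (m ℕ.* p)) eq)
  (trans (cong (λ k → sign (p + k)) (*-distribʳ-+ p ⌊ m /2⌋ ⌊ m /2⌋))
         (sign-+-self p (⌊ m /2⌋ ℕ.* p)))

-- Modulo 2, an odd multiplicity acts as 1 and an even one as 0.
sign-filter-odd : (m : ℕ → ℕ) (odd-m? : Decidable (λ p → ¬ 2 ∣ m p)) (us : List ℕ) →
  sign (sum (filter odd-m? us)) ≡ sign (sum (map (λ p → m p ℕ.* p) us))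
sign-filter-odd m odd-m? []       = refl
sign-filter-odd m odd-m? (p ∷ us) with odd-m? p
... | yes 2∤ = trans (sign-+ p (sum (filter odd-m? us))) (trans
  (cong₂ _*_ (sym (sign-*-odd p 2∤)) (sign-filter-odd m odd-m? us))
  (sym (sign-+ (m p ℕ.* p) _)))
... | no ¬2∤ = trans (sign-filter-odd m odd-m? us) (sym (trans
  (sign-+ (m p ℕ.* p) _)
  (trans (cong (_* sign (sum (map (λ p → m p ℕ.* p) us))) (sign-*-even p (decidable-stable (2 ∣? m p) ¬2∤))) (ℤ.*-identityˡ _))))

sign-s : ∀ μ → sign ∣ s μ ∣ ≡ sign (sum (parts μ))
sign-s μ = begin
  sign ∣ s μ ∣                                    ≡⟨ sign-alternatingSum (oddMultiplicityParts μ) ⟩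
  sign (sum (oddMultiplicityParts μ))             ≡⟨ sign-filter-odd (multiplicity μ) _ (deduplicate _≟_ xs) ⟩
  sign (weighted xs (deduplicate _≟_ xs))         ≡⟨ cong sign (weighted-sum (deduplicate-! xs) xs (∈-deduplicate⁺ _≟_)) ⟩
  sign (sum xs)                                   ∎
  where
  open ≡-Reasoning
  xs = parts μ

sign-ρ : ∀ μ → sign ∣ ρ μ ∣ ≡ sign (sum (parts μ)) * sign (r μ)
sign-ρ μ = trans (sign-∣-∣ (r μ) (s μ))
  (trans (cong (sign (r μ) *_) (sign-s μ)) (ℤ.*-comm (sign (r μ)) _))

-- Decreasing lists

Decreasing : List ℕ → Set
Decreasing = Linked _≥_

decreasing-∷ : ∀ {x xs} → nth xs 0 ≤ x → Decreasing xs → Decreasing (x ∷ xs)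
decreasing-∷ {xs = []}    h d = [-]
decreasing-∷ {xs = _ ∷ _} h d = h ∷ d

decreasing-head : ∀ {x xs} → Decreasing (x ∷ xs) → nth xs 0 ≤ x
decreasing-head [-]     = z≤n
decreasing-head (h ∷ _) = h

nth-≤-head : ∀ {xs} → Decreasing xs → ∀ i → nth xs i ≤ nth xs 0
nth-≤-head {[]}     d i       = z≤n
nth-≤-head {x ∷ xs} d zero    = ≤-refl
nth-≤-head {x ∷ xs} d (suc i) = ≤-trans (nth-≤-head (Linked.tail d) i) (decreasing-head d)

nth-antitone : ∀ {xs} → Decreasing xs → ∀ {i j} → i ≤ j → nth xs j ≤ nth xs i
nth-antitone         d {j = j} z≤n       = nth-≤-head d j
nth-antitone {[]}    d         (s≤s i≤j) = z≤n
nth-antitone {_ ∷ _} d         (s≤s i≤j) = nth-antitone (Linked.tail d) i≤j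

all-≤-head : ∀ {xs} → Decreasing xs → All (_≤ nth xs 0) xs
all-≤-head {[]}     d = []
all-≤-head {x ∷ xs} d =
  ≤-refl ∷ All.map (λ h → ≤-trans h (decreasing-head d)) (all-≤-head (Linked.tail d))

-- Positivity separates genuine parts from the default value 0 past the end, so the lengths agree
-- too.
nth-ext : ∀ {xs ys} → All (1 ≤_) xs → All (1 ≤_) ys → (∀ i → nth xs i ≡ nth ys i) → xs ≡ ys
nth-ext []       []       eq = refl
nth-ext []       (q ∷ qs) eq = contradiction (subst (1 ≤_) (sym (eq 0)) q) λ ()
nth-ext (p ∷ ps) []       eq = contradiction (subst (1 ≤_) (eq 0) p) λ ()
nth-ext (p ∷ ps) (q ∷ qs) eq = cong₂ _∷_ (eq 0) (nth-ext ps qs (eq ∘ suc))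

-- A row length is determined by the columns that the row meets; equalities of parts thereby reduce
-- to statements about single cells.
<-ext : ∀ {m n} → (∀ j → j < m → j < n) → (∀ j → j < n → j < m) → m ≡ n
<-ext {m} {n} f g with <-cmp m n
... | tri< m<n _ _ = contradiction (g m m<n) (<-irrefl refl)
... | tri≈ _ m≡n _ = m≡n
... | tri> _ _ n<m = contradiction (f n n<m) (<-irrefl refl)

-- Conjugation

columnLength-beyond : ∀ {xs j} → Decreasing xs → nth xs 0 ≤ j → columnLength xs j ≡ 0
columnLength-beyond {j = j} d h =
  cong length (filter-none (j <?_) (All.map (λ x≤ → ≤⇒≯ (≤-trans x≤ h)) (all-≤-head d)))

columnLength-∷ : ∀ {x j} xs → j < x → columnLength (x ∷ xs) j ≡ suc (columnLength xs j)
columnLength-∷ {x} {j} xs j<x = cong length (filter-accept (j <?_) {x} {xs} j<x)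

-- In a decreasing list the parts exceeding `j` form an initial segment, so their number exceeds `i`
-- exactly when the part with index `i` is among them; `columnLength-⇐` is the other direction.
columnLength-⇒ : ∀ {xs} → Decreasing xs → ∀ {i j} → i < columnLength xs j → j < nth xs i
columnLength-⇒ {x ∷ xs} d {i} {j} i< with j <? x
columnLength-⇒ {x ∷ xs} d {i} {j} i< | no j≮x =
  contradiction (subst (i <_) (columnLength-beyond {x ∷ xs} d (≮⇒≥ j≮x)) i<) λ ()
columnLength-⇒ {x ∷ xs} d {zero}  {j} i< | yes j<x = j<x
columnLength-⇒ {x ∷ xs} d {suc i} {j} i< | yes j<x =
  columnLength-⇒ (Linked.tail d) (≤-pred (subst (suc i <_) (columnLength-∷ xs j<x) i<))

columnLength-⇐ : ∀ {xs} → Decreasing xs → ∀ {i j} → j < nth xs i → i < columnLength xs j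
columnLength-⇐ {x ∷ xs} d {i} {j} j< =
  subst (i <_) (sym (columnLength-∷ xs j<x)) (rest i j<)
  where
  j<x : j < x
  j<x = ≤-trans j< (nth-≤-head d i)
  rest : ∀ i → j < nth (x ∷ xs) i → i < suc (columnLength xs j)
  rest zero    _  = s≤s z≤n
  rest (suc i) j< = s≤s (columnLength-⇐ (Linked.tail d) j<)

nth-applyUpTo : ∀ (f : ℕ → ℕ) n {j} → j < n → nth (applyUpTo f n) j ≡ f j
nth-applyUpTo f (suc n) {zero}  _         = refl
nth-applyUpTo f (suc n) {suc j} (s≤s j<n) = nth-applyUpTo (f ∘ suc) n j<n

nth-applyUpTo-beyond : ∀ (f : ℕ → ℕ) n {j} → n ≤ j → nth (applyUpTo f n) j ≡ 0
nth-applyUpTo-beyond f zero            _         = refl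
nth-applyUpTo-beyond f (suc n) {suc j} (s≤s n≤j) = nth-applyUpTo-beyond (f ∘ suc) n n≤j

-- The list of the conjugate stops after `part μ 0` columns; from there on both sides are 0, so `j`
-- is unrestricted.
part-conjugate : ∀ μ j → part (conjugate μ) j ≡ columnLength (parts μ) j
part-conjugate μ j = trans (cong (λ xs → nth xs j) (map-upTo (columnLength (parts μ)) (part μ 0))) go
  where
  go : nth (applyUpTo (columnLength (parts μ)) (part μ 0)) j ≡ columnLength (parts μ) j
  go with j <? part μ 0
  ... | yes j< = nth-applyUpTo (columnLength (parts μ)) (part μ 0) j<
  ... | no j≮  = trans (nth-applyUpTo-beyond (columnLength (parts μ)) (part μ 0) (≮⇒≥ j≮))
                       (sym (columnLength-beyond (decreasing μ) (≮⇒≥ j≮)))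

conjugate-⇒ : ∀ μ {i j} → i < part (conjugate μ) j → j < part μ i
conjugate-⇒ μ {i} {j} h = columnLength-⇒ (decreasing μ) (subst (i <_) (part-conjugate μ j) h)

conjugate-⇐ : ∀ μ {i j} → j < part μ i → i < part (conjugate μ) j
conjugate-⇐ μ {i} {j} h = subst (i <_) (sym (part-conjugate μ j)) (columnLength-⇐ (decreasing μ) h)

part-ext : ∀ {μ ν} → (∀ i → part μ i ≡ part ν i) → μ ≡ ν
part-ext {μ} {ν} eq = parts-injective (nth-ext (positive μ) (positive ν) eq)

conjugate-involutive : ∀ μ → conjugate (conjugate μ) ≡ μ
conjugate-involutive μ = part-ext λ i → <-ext
  (λ j h → conjugate-⇒ μ (conjugate-⇒ (conjugate μ) h))
  (λ j h → conjugate-⇐ (conjugate μ) (conjugate-⇐ μ h))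

-- The step of the double counting in `sum-columnLength`: a new part `x` lengthens the first `x`
-- columns by one cell and leaves the others alone.
sum-applyUpTo-bump : ∀ {x n} {f g : ℕ → ℕ} → x ≤ n →
  (∀ {j} → j < x → f j ≡ suc (g j)) → (∀ {j} → x ≤ j → f j ≡ g j) →
  sum (applyUpTo f n) ≡ x + sum (applyUpTo g n)
sum-applyUpTo-bump {zero}  {zero}  _         lo hi = refl
sum-applyUpTo-bump {zero}  {suc n} _         lo hi =
  cong₂ _+_ (hi z≤n) (sum-applyUpTo-bump {zero} {n} z≤n (λ ()) (λ _ → hi z≤n))
sum-applyUpTo-bump {suc x} {suc n} {f} {g} (s≤s x≤n) lo hi = begin
  f 0 + sum (applyUpTo (f ∘ suc) n)  ≡⟨ cong₂ _+_ (lo (s≤s z≤n))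
    (sum-applyUpTo-bump x≤n (lo ∘ s≤s) (hi ∘ s≤s)) ⟩
  suc (g 0 + (x + S))                ≡⟨ cong suc (+-assoc (g 0) x S) ⟨
  suc (g 0 + x + S)                  ≡⟨ cong (λ k → suc (k + S)) (+-comm (g 0) x) ⟩
  suc (x + g 0 + S)                  ≡⟨ cong suc (+-assoc x (g 0) S) ⟩
  suc (x + (g 0 + S))                ∎
  where
  open ≡-Reasoning
  S = sum (applyUpTo (g ∘ suc) n)

sum-columnLength : ∀ {xs n} → All (_≤ n) xs → sum (applyUpTo (columnLength xs) n) ≡ sum xs
sum-columnLength {n = n} [] = zeros n
  where
  zeros : ∀ n → sum (applyUpTo (columnLength []) n) ≡ 0
  zeros zero    = refl
  zeros (suc n) = zeros n
sum-columnLength {x ∷ xs} (x≤n ∷ xs≤n) = trans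
  (sum-applyUpTo-bump x≤n (columnLength-∷ xs)
    (λ {j} x≤j → cong length (filter-reject (j <?_) {x} {xs} (≤⇒≯ x≤j))))
  (cong (x ℕ.+_) (sum-columnLength xs≤n))

sum-conjugate : ∀ μ → sum (parts (conjugate μ)) ≡ sum (parts μ)
sum-conjugate μ = trans (cong sum (map-upTo (columnLength (parts μ)) (part μ 0)))
                        (sum-columnLength (all-≤-head (decreasing μ)))

head-conjugate : ∀ μ → part (conjugate μ) 0 ≡ length (parts μ)
head-conjugate μ = trans (part-conjugate μ 0) (cong length (filter-all (0 <?_) (positive μ)))

-- Self-conjugacy

0<nth⇒<length : ∀ xs {i} → 0 < nth xs i → i < length xs
0<nth⇒<length (x ∷ xs) {zero}  _ = s≤s z≤n
0<nth⇒<length (x ∷ xs) {suc i} h = s≤s (0<nth⇒<length xs h)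

durfee-fits : ∀ μ → SquareFits μ (durfee μ)
durfee-fits μ = Extrema.argmax-all id {P = SquareFits μ} (λ ())
  (all-filter (squareFits? μ) (upTo (suc (length (parts μ)))))

-- The search in `durfee` stops at the number of parts. Nothing is lost: a square of positive side
-- `e` meets row `e - 1`, which must then be non-empty.
durfee-maximal : ∀ μ {e} → SquareFits μ e → e ≤ durfee μ
durfee-maximal μ {e} fits = All.lookup (Extrema.xs≤max 0 _)
  (∈-filter⁺ (squareFits? μ) (∈-upTo⁺ (s≤s (bound e fits))) (λ {i} → fits {i}))
  where
  bound : ∀ e → SquareFits μ e → e ≤ length (parts μ)
  bound zero    _    = z≤n
  bound (suc e) fits = 0<nth⇒<length (parts μ) (fits (n<1+n e) (s≤s z≤n))

-- If row `d` were longer than `d`, so would be all rows above it, and a square of side `d + 1`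
-- would fit.
part-durfee : ∀ μ → part μ (durfee μ) ≤ durfee μ
part-durfee μ = ≮⇒≥ λ d<part → <-irrefl refl (durfee-maximal μ
  (λ i< j< → ≤-trans j< (≤-trans d<part (nth-antitone (decreasing μ) (≤-pred i<)))))

-- Were row `i` shorter than the square, the column with index `part μ i` would cross the square,
-- and `durfee-fits` would give `part μ i < part μ i`.
durfee≤part : ∀ μ {i} → i < durfee μ → durfee μ ≤ part μ i
durfee≤part μ {i} i<d = ≮⇒≥ λ part<d → <-irrefl refl (durfee-fits μ i<d part<d)

durfee≤part-conjugate : ∀ μ {j} → j < durfee μ → durfee μ ≤ part (conjugate μ) j
durfee≤part-conjugate μ {j} j<d =
  ≮⇒≥ λ part<d → <-irrefl refl (conjugate-⇐ μ (durfee-fits μ part<d j<d))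

selfConjugate-⇒ : ∀ μ → conjugate μ ≡ μ → ∀ {i j} → i < part μ j → j < part μ i
selfConjugate-⇒ μ eq {i} {j} h = conjugate-⇒ μ (subst (λ ν → i < part ν j) (sym eq) h)

selfConjugate-⇐ : ∀ μ → (∀ {i j} → i < part μ j → j < part μ i) → conjugate μ ≡ μ
selfConjugate-⇐ μ symm = part-ext λ i → <-ext
  (λ j h → symm (conjugate-⇒ μ h))
  (λ j h → conjugate-⇐ μ (symm h))

-- The rows from the Durfee square on lie below it, and so are read off
-- the columns that pass through it.
durfeeRows⇒selfConjugate : ∀ μ → (∀ {i} → i < durfee μ → part μ i ≡ part (conjugate μ) i) →
                           conjugate μ ≡ μ
durfeeRows⇒selfConjugate μ eq = selfConjugate-⇐ μ symm
  where
  d = durfee μ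
  symm : ∀ {i j} → i < part μ j → j < part μ i
  symm {i} {j} h with i <? d | j <? d
  ... | yes i<d | _       = subst (j <_) (sym (eq i<d)) (conjugate-⇐ μ h)
  ... | no _    | yes j<d = conjugate-⇒ μ (subst (i <_) (eq j<d) h)
  -- No cell has both coordinates at least `d`, since `i < part μ j ≤ part μ d ≤ d`.
  ... | no i≮d  | no j≮d  = contradiction
    (≤-trans h (≤-trans (nth-antitone (decreasing μ) (≮⇒≥ j≮d)) (part-durfee μ))) i≮d

-- Partitions without diagonal blocks

concatMap-[] : {A B : Set} (f : A → List B) (xs : List A) →
               (∀ x → f x ≡ []) → concatMap f xs ≡ []
concatMap-[] f []       h = refl
concatMap-[] f (x ∷ xs) h = cong₂ _++_ (h x) (concatMap-[] f xs h)

-- Deduplication always keeps the first cell of a non-empty list.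
#components≡0 : ∀ S → #components S ≡ 0 → S ≡ []
#components≡0 [] _ = refl

row : Partition → ℕ → List Cell
row μ i = map (i ,_) (filter (I μ i ≤?_) (upTo (U μ i)))

-- A row with `I μ i < U μ i` would contribute the cell in column `I μ i`. Hence `α` and `β` agree
-- on the rows through the Durfee square, where subtracting its side does not truncate.
κ≡0⇒selfConjugate : ∀ μ → κ μ ≡ 0 → conjugate μ ≡ μ
κ≡0⇒selfConjugate μ κ≡0 = durfeeRows⇒selfConjugate μ equal
  where
  cell : ∀ {i} → i < durfee μ → I μ i < U μ i → (i , I μ i) ∈ U/I μ
  cell {i} i<d I<U = ∈-concat⁺′
    (∈-map⁺ (i ,_) (∈-filter⁺ (I μ i ≤?_) (∈-upTo⁺ I<U) ≤-refl))
    (∈-map⁺ (row μ) (∈-upTo⁺ i<d))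
  no-cell : ∀ {c} → ¬ c ∈ U/I μ
  no-cell c∈ with () ← subst (_ ∈_) (#components≡0 (U/I μ) κ≡0) c∈
  equal : ∀ {i} → i < durfee μ → part μ i ≡ part (conjugate μ) i
  equal {i} i<d = ∸-cancelʳ-≡ (durfee≤part μ i<d) (durfee≤part-conjugate μ i<d)
    (≤-antisym
      (≤-trans (m≤m⊔n (α μ i) (β μ i)) (≤-trans U≤I (m⊓n≤n (α μ i) (β μ i))))
      (≤-trans (m≤n⊔m (α μ i) (β μ i)) (≤-trans U≤I (m⊓n≤m (α μ i) (β μ i)))))
    where
    U≤I : U μ i ≤ I μ i
    U≤I = ≮⇒≥ (no-cell ∘ cell i<d)

selfConjugate⇒κ≡0 : ∀ μ → conjugate μ ≡ μ → κ μ ≡ 0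
selfConjugate⇒κ≡0 μ eq = cong #components (concatMap-[] (row μ) (upTo (durfee μ)) λ i →
  cong (map (i ,_)) (filter-none (I μ i ≤?_) (All.tabulate (λ {j} j∈ → <⇒≱ (j<I i j∈)))))
  where
  j<I : ∀ i {j} → j ∈ upTo (U μ i) → j < I μ i
  j<I i {j} j∈ = subst (j <_) (trans (cong (α μ i ⊔_) β≡α) (trans (⊔-idem (α μ i))
    (sym (trans (cong (α μ i ⊓_) β≡α) (⊓-idem (α μ i)))))) (∈-upTo⁻ j∈)
    where
    β≡α : β μ i ≡ α μ i
    β≡α = cong (λ ν → part ν i ∸ durfee μ) eq

κ≡0⇔selfConjugate : ∀ μ → κ μ ≡ 0 ⇔ conjugate μ ≡ μ
κ≡0⇔selfConjugate μ = mk⇔ (κ≡0⇒selfConjugate μ) (selfConjugate⇒κ≡0 μ)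

-- Splitting off pairs of equal parts

Strict : List ℕ → Set
Strict = Linked _>_

strict-∷ : ∀ {x xs} → nth xs 0 < x → Strict xs → Strict (x ∷ xs)
strict-∷ {xs = []}    h d = [-]
strict-∷ {xs = _ ∷ _} h d = h ∷ d

strict-head : ∀ {x xs} → 1 ≤ x → Strict (x ∷ xs) → nth xs 0 < x
strict-head 1≤x [-]     = 1≤x
strict-head 1≤x (h ∷ _) = h

-- Branching is delegated to a function so that `split` and `toggle` can be rewritten along either
-- branch by `decide-yes` and `decide-no`.
decide : {P A : Set} → Dec P → A → A → A
decide (yes _) a b = a
decide (no _)  a b = b

decide-yes : {P A : Set} (P? : Dec P) {a b : A} → P → decide P? a b ≡ a
decide-yes (yes _) p = refl
decide-yes (no ¬p) p = contradiction p ¬p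

decide-no : {P A : Set} (P? : Dec P) {a b : A} → ¬ P → decide P? a b ≡ b
decide-no (yes p) ¬p = contradiction p ¬p
decide-no (no _)  ¬p = refl

-- Equal parts of a decreasing list are adjacent, so pairing greedily from the left leaves one
-- single copy of each part of odd multiplicity.
split : List ℕ → List ℕ × List ℕ
split []           = [] , []
split (x ∷ [])     = x ∷ [] , []
split (x ∷ y ∷ xs) = decide (x ≟ y) (map₂ (x ∷_) (split xs)) (map₁ (x ∷_) (split (y ∷ xs)))

singles pairs : List ℕ → List ℕ
singles = proj₁ ∘ split
pairs   = proj₂ ∘ split

split-pair : ∀ x xs → split (x ∷ x ∷ xs) ≡ (singles xs , x ∷ pairs xs)
split-pair x xs = decide-yes (x ≟ x) refl

split-single : ∀ {x} xs → nth xs 0 < x → split (x ∷ xs) ≡ (x ∷ singles xs , pairs xs)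
split-single     []       _   = refl
split-single {x} (y ∷ xs) y<x = decide-no (x ≟ y) (<⇒≢ y<x ∘ sym)

-- The recursion pattern of `split` on a partition. A paired value may recur in the rest, a single
-- one may not; as `nth [] 0` is 0, the bound in `single` also makes `x` positive.
data Blocks : List ℕ → Set where
  []     : Blocks []
  pair   : ∀ {x xs} → 1 ≤ x → nth xs 0 ≤ x → Blocks xs → Blocks (x ∷ x ∷ xs)
  single : ∀ {x xs} → nth xs 0 < x → Blocks xs → Blocks (x ∷ xs)

blocks : ∀ {xs} → Decreasing xs → All (1 ≤_) xs → Blocks xs
blocks []              []             = []
blocks [-]             (p ∷ [])       = single p []
blocks {x ∷ y ∷ xs} (y≤x ∷ d) (p ∷ q ∷ ps) =
  first (x ≟ y) (blocks d (q ∷ ps)) (blocks (Linked.tail d) ps)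
  where
  first : Dec (x ≡ y) → Blocks (y ∷ xs) → Blocks xs → Blocks (x ∷ y ∷ xs)
  first (yes refl) _ b = pair p (decreasing-head d) b
  first (no x≢y)   b _ = single (≤∧≢⇒< y≤x (x≢y ∘ sym)) b

blocks-decreasing : ∀ {xs} → Blocks xs → Decreasing xs
blocks-decreasing []           = []
blocks-decreasing (pair _ h b) = ≤-refl ∷ decreasing-∷ h (blocks-decreasing b)
blocks-decreasing (single h b) = decreasing-∷ (<⇒≤ h) (blocks-decreasing b)

blocks-positive : ∀ {xs} → Blocks xs → All (1 ≤_) xs
blocks-positive []           = []
blocks-positive (pair p _ b) = p ∷ p ∷ blocks-positive b
blocks-positive (single h b) = ≤-trans (s≤s z≤n) h ∷ blocks-positive b

record Valid (μν : List ℕ × List ℕ) : Set where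
  constructor valid
  field
    strict      : Strict (proj₁ μν)
    μ-positive  : All (1 ≤_) (proj₁ μν)
    weak        : Decreasing (proj₂ μν)
    ν-positive  : All (1 ≤_) (proj₂ μν)

size : List ℕ × List ℕ → ℕ
size (μ , ν) = sum μ + (sum ν + sum ν)

-- The bounds on the two heads strengthen the induction: they keep the singles strict and the pairs
-- decreasing when a part is put in front.
record Splitting (xs : List ℕ) (μν : List ℕ × List ℕ) : Set where
  constructor splitting
  field
    isValid  : Valid μν
    singles≤ : nth (proj₁ μν) 0 ≤ nth xs 0
    pairs≤   : nth (proj₂ μν) 0 ≤ nth xs 0
    sizes    : size μν ≡ sum xs

size-pair : ∀ x m n → m + ((x + n) + (x + n)) ≡ x + (x + (m + (n + n)))
size-pair = ℕ-solve-∀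

split-splitting : ∀ {xs} → Blocks xs → Splitting xs (split xs)
split-splitting [] = splitting (valid [] [] [] []) z≤n z≤n refl
split-splitting (pair {x} {xs} p h b) rewrite split-pair x xs with split-splitting b
... | splitting (valid s ps w qs) sh ph sz = splitting
  (valid s ps (decreasing-∷ (≤-trans ph h) w) (p ∷ qs)) (≤-trans sh h) ≤-refl
  (trans (size-pair x (sum (singles xs)) (sum (pairs xs))) (cong (λ k → x + (x + k)) sz))
split-splitting (single {x} {xs} h b) rewrite split-single xs h with split-splitting b
... | splitting (valid s ps w qs) sh ph sz = splitting
  (valid (strict-∷ (≤-<-trans sh h) s) (≤-trans (s≤s z≤n) h ∷ ps) w qs) ≤-refl
  (≤-trans ph (<⇒≤ h))
  (trans (+-assoc x _ _) (cong (x ℕ.+_) sz))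

-- If the splittings agreed, `x` would head the pairs of `ys`, whence `x < y`, while `y` would head
-- the singles of `xs`, whence `y ≤ x`.
pair≢single : ∀ {x y xs ys} → nth xs 0 ≤ x → Blocks xs → nth ys 0 < y → Blocks ys →
              split (x ∷ x ∷ xs) ≢ split (y ∷ ys)
pair≢single {x} {y} {xs} {ys} h b k c eq
  rewrite split-pair x xs | split-single ys k = <-irrefl refl (begin-strict
  x                 ≡⟨ cong (λ μν → nth (proj₂ μν) 0) eq ⟩
  nth (pairs ys) 0  ≤⟨ Splitting.pairs≤ (split-splitting c) ⟩
  nth ys 0          <⟨ k ⟩
  y                 ≡⟨ cong (λ μν → nth (proj₁ μν) 0) eq ⟨
  nth (singles xs) 0 ≤⟨ Splitting.singles≤ (split-splitting b) ⟩
  nth xs 0          ≤⟨ h ⟩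
  x                 ∎)
  where open ≤-Reasoning

split-injective : ∀ {xs ys} → Blocks xs → Blocks ys → split xs ≡ split ys → xs ≡ ys
split-injective []                       []                       eq = refl
split-injective []                       (pair {y} {ys} _ _ _)    eq rewrite split-pair y ys     with () ← cong proj₂ eq
split-injective []                       (single {y} {ys} h _)    eq rewrite split-single ys h   with () ← cong proj₁ eq
split-injective (pair {x} {xs} _ _ _)    []                       eq rewrite split-pair x xs     with () ← cong proj₂ eq
split-injective (single {x} {xs} h _)    []                       eq rewrite split-single xs h   with () ← cong proj₁ eq
split-injective (pair {x} {xs} _ _ b)    (pair {y} {ys} _ _ c)    eq
  rewrite split-pair x xs | split-pair y ys with ,-injective eq
... | eq₁ , eq₂ with ∷-injective eq₂
... | refl , eq₃ = cong (λ zs → x ∷ x ∷ zs) (split-injective b c (cong₂ _,_ eq₁ eq₃))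
split-injective (single {x} {xs} h b)    (single {y} {ys} k c)    eq
  rewrite split-single xs h | split-single ys k with ,-injective eq
... | eq₁ , eq₂ with ∷-injective eq₁
... | refl , eq₃ = cong (x ∷_) (split-injective b c (cong₂ _,_ eq₃ eq₂))
split-injective (pair {x} {xs} _ h b)    (single {y} {ys} k c)    eq =
  contradiction eq (pair≢single h b k c)
split-injective (single {y} {ys} k c)    (pair {x} {xs} _ h b)    eq =
  contradiction (sym eq) (pair≢single h b k c)

record Merged (μ ν : List ℕ) : Set where
  constructor merged
  field
    {union}  : List ℕ
    isBlocks : Blocks union
    union≤   : nth union 0 ≤ nth μ 0 ⊔ nth ν 0
    split≡   : split union ≡ (μ , ν)

split-surjective : ∀ μ ν → Valid (μ , ν) → Merged μ ν
split-surjective [] [] _ = merged [] z≤n refl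
split-surjective [] (p ∷ ν) (valid s ps w (q ∷ qs))
  with split-surjective [] ν (valid s ps (Linked.tail w) qs)
... | merged {xs} b h eq = merged (pair q (≤-trans h (decreasing-head w)) b) ≤-refl
  (trans (split-pair p xs) (cong (map₂ (p ∷_)) eq))
split-surjective (x ∷ μ) [] (valid s (p ∷ ps) w qs)
  with split-surjective μ [] (valid (Linked.tail s) ps w qs)
... | merged {xs} b h eq = merged (single x> b) (m≤m⊔n x 0)
  (trans (split-single xs x>) (cong (map₁ (x ∷_)) eq))
  where
  x> : nth xs 0 < x
  x> = ≤-<-trans h (subst (_< x) (sym (⊔-identityʳ (nth μ 0))) (strict-head p s))
split-surjective (x ∷ μ) (y ∷ ν) (valid s (p ∷ ps) w (q ∷ qs)) =
  -- The larger head goes first. A tie goes to the pair, because a single part must exceed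
  -- everything after it.
  first (x ≤? y)
    (split-surjective (x ∷ μ) ν (valid s (p ∷ ps) (Linked.tail w) qs))
    (split-surjective μ (y ∷ ν) (valid (Linked.tail s) ps w (q ∷ qs)))
  where
  first : Dec (x ≤ y) → Merged (x ∷ μ) ν → Merged μ (y ∷ ν) → Merged (x ∷ μ) (y ∷ ν)
  first (yes x≤y) (merged {xs} b h eq) _ =
    merged (pair q (≤-trans h (⊔-lub x≤y (decreasing-head w))) b) (m≤n⊔m x y)
      (trans (split-pair y xs) (cong (map₂ (y ∷_)) eq))
  first (no x≰y) _ (merged {xs} b h eq) =
    merged (single x> b) (m≤m⊔n x y) (trans (split-single xs x>) (cong (map₁ (x ∷_)) eq))
    where
    x> : nth xs 0 < x
    x> = ≤-<-trans h (⊔-pres-<m (strict-head p s) (≰⇒> x≰y))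

-- The largest repeated part

count≟-≥ : ∀ {p x} xs → count≟ p xs ≤ count≟ p (x ∷ xs)
count≟-≥ {p} {x} xs with p ≟ x
... | yes refl = subst (count≟ p xs ≤_) (sym (cong length (filter-accept (p ≟_) {x} {xs} refl))) (n≤1+n _)
... | no p≢x   = ≤-reflexive (sym (cong length (filter-reject (p ≟_) {x} {xs} p≢x)))

count≟-here : ∀ x xs → count≟ x (x ∷ xs) ≡ suc (count≟ x xs)
count≟-here x xs = cong length (filter-accept (x ≟_) {x} {xs} refl)

count≟-there : ∀ {p x} xs → p ≢ x → count≟ p (x ∷ xs) ≡ count≟ p xs
count≟-there {p} {x} xs p≢x = cong length (filter-reject (p ≟_) {x} {xs} p≢x)

count≟-large : ∀ {p xs} → Decreasing xs → nth xs 0 < p → count≟ p xs ≡ 0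
count≟-large {p} d h = cong length (filter-none (p ≟_)
  (All.map (λ x≤ p≡x → <-irrefl (sym p≡x) (≤-<-trans x≤ h)) (all-≤-head d)))

-- The parts passed before the first pair are strictly larger than all that follows, so they occur
-- once; the first pair therefore dominates every repeated part.
repeated-≤ : ∀ {xs} → Blocks xs → ∀ {p} → p ∈ xs → 2 ≤ count≟ p xs → p ≤ nth (pairs xs) 0
repeated-≤ b@(pair {x} {xs} _ h _) {p} p∈ _ rewrite split-pair x xs =
  All.lookup (all-≤-head (blocks-decreasing b)) p∈
repeated-≤ (single {x} {xs} h b) {p} p∈ 2≤ rewrite split-single xs h with p ≟ x
... | yes refl = contradiction (subst (2 ≤_) (trans (count≟-here x xs)
  (cong suc (count≟-large (blocks-decreasing b) h))) 2≤) λ { (s≤s ()) }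
... | no p≢x with p∈
...   | here p≡x = contradiction p≡x p≢x
...   | there p∈′ = repeated-≤ b p∈′ (subst (2 ≤_) (count≟-there xs p≢x) 2≤)

-- When there is no pair, the default 0 of `nth` coincides with the default 0 of the maximum in `r`.
head-pairs-repeated : ∀ {xs} → Blocks xs → nth (pairs xs) 0 ≡ 0 ⊎
  (nth (pairs xs) 0 ∈ xs × 2 ≤ count≟ (nth (pairs xs) 0) xs)
head-pairs-repeated [] = inj₁ refl
head-pairs-repeated (pair {x} {xs} _ _ _) rewrite split-pair x xs = inj₂ (here refl ,
  subst (2 ≤_) (sym (trans (count≟-here x (x ∷ xs)) (cong suc (count≟-here x xs)))) (s≤s (s≤s z≤n)))
head-pairs-repeated (single {x} {xs} h b) rewrite split-single xs h with head-pairs-repeated b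
... | inj₁ eq        = inj₁ eq
... | inj₂ (x∈ , 2≤) = inj₂ (there x∈ , ≤-trans 2≤ (count≟-≥ xs))

partition-blocks : ∀ μ → Blocks (parts μ)
partition-blocks μ = blocks (decreasing μ) (positive μ)

r≡head-pairs : ∀ μ → r μ ≡ nth (pairs (parts μ)) 0
r≡head-pairs μ = ≤-antisym (Extrema.max≤v⁺ z≤n (All.tabulate upper)) lower
  where
  b = partition-blocks μ
  repeated? = λ p → 2 ≤? multiplicity μ p
  upper : ∀ {p} → p ∈ filter repeated? (parts μ) → p ≤ nth (pairs (parts μ)) 0
  upper p∈ with ∈-filter⁻ repeated? {xs = parts μ} p∈
  ... | p∈ , 2≤ = repeated-≤ b p∈ 2≤
  lower : nth (pairs (parts μ)) 0 ≤ r μ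
  lower with head-pairs-repeated b
  ... | inj₁ eq       = subst (_≤ r μ) (sym eq) z≤n
  ... | inj₂ (h∈ , 2≤) = All.lookup (Extrema.xs≤max 0 (filter repeated? (parts μ)))
                                   (∈-filter⁺ repeated? h∈ 2≤)

-- The list of all splittings of a given size

splittings : ℕ → List (List ℕ × List ℕ)
splittings n = map (split ∘ parts) (partitions n)

splittings-unique : ∀ n → Unique (splittings n)
splittings-unique n = Unique-map (split ∘ parts) (partitions-unique n) λ {μ} {ν} _ _ eq →
  parts-injective (split-injective (partition-blocks μ) (partition-blocks ν) eq)

splittings-sound : ∀ n {μν} → μν ∈ splittings n → Valid μν × size μν ≡ n
splittings-sound n μν∈ with ∈-map⁻ (split ∘ parts) μν∈
... | π , π∈ , refl with split-splitting (partition-blocks π)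
...   | splitting v _ _ sz = v , trans sz (partitions-sound n π∈)

-- With soundness and uniqueness, this makes `splittings n` an exact enumeration of the valid pairs
-- of size `n`, so that the involutions below can be checked on pairs alone.
splittings-complete : ∀ n {μν} → Valid μν → size μν ≡ n → μν ∈ splittings n
splittings-complete n {μ , ν} v eq with split-surjective μ ν v
... | merged {xs} b _ split≡ = subst (_∈ splittings n) split≡
  (∈-map⁺ (split ∘ parts) (partitions-complete n {partition xs (blocks-decreasing b) (blocks-positive b)}
    (trans (sym (Splitting.sizes (split-splitting b))) (trans (cong size split≡) eq))))

-- Conjugating the pairs

-- The second component is the list of `conjugate`, unfolded so that the map is defined on arbitrary
-- pairs of lists.
conjugatePairs : List ℕ × List ℕ → List ℕ × List ℕ
conjugatePairs (μ , ν) = μ , map (columnLength ν) (upTo (nth ν 0))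

conjugatePairs-valid : ∀ {μν} → Valid μν → Valid (conjugatePairs μν)
conjugatePairs-valid {_ , ν} (valid s ps w qs) =
  valid s ps (decreasing (conjugate (partition ν w qs))) (positive (conjugate (partition ν w qs)))

conjugatePairs-size : ∀ {μν} → Valid μν → size (conjugatePairs μν) ≡ size μν
conjugatePairs-size {μ , ν} (valid s ps w qs) =
  cong (λ k → sum μ + (k + k)) (sum-conjugate (partition ν w qs))

conjugatePairs-involutive : ∀ {μν} → Valid μν → conjugatePairs (conjugatePairs μν) ≡ μν
conjugatePairs-involutive {μ , ν} (valid s ps w qs) =
  cong (λ π → μ , parts π) (conjugate-involutive (partition ν w qs))

∑-conjugatePairs : ∀ n → ∑ (λ μν → sign (nth (proj₂ μν) 0)) (splittings n) ≡
                         ∑ (sign ∘ length ∘ proj₂) (splittings n)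
∑-conjugatePairs n = trans
  (sym (∑-involution (λ μν → sign (nth (proj₂ μν) 0)) conjugatePairs (splittings-unique n)
    into (conjugatePairs-involutive ∘ proj₁ ∘ splittings-sound n)))
  (∑-cong (splittings n) heads)
  where
  into : ∀ {μν} → μν ∈ splittings n → conjugatePairs μν ∈ splittings n
  into μν∈ with splittings-sound n μν∈
  ... | v , sz = splittings-complete n (conjugatePairs-valid v) (trans (conjugatePairs-size v) sz)
  heads : ∀ {μν} → μν ∈ splittings n →
          sign (nth (proj₂ (conjugatePairs μν)) 0) ≡ sign (length (proj₂ μν))
  heads {_ , ν} μν∈ with splittings-sound n μν∈
  ... | valid _ _ w qs , _ = cong sign (head-conjugate (partition ν w qs))

-- Exchanging a pair p , p for the part 2p

Oddℕ : ℕ → Set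
Oddℕ n = n ≡ suc (⌊ n /2⌋ + ⌊ n /2⌋)

-- From `n < m` would follow `m + m ≥ n + n + 2`; the slack of one lets the bound serve odd parts as
-- well.
half-≤ : ∀ {m n} → m + m ≤ suc (n + n) → m ≤ n
half-≤ {m} {n} h = ≮⇒≥ λ n<m → <-irrefl refl
  (≤-pred (≤-trans (≤-trans (≤-reflexive (cong suc (sym (+-suc n n)))) (+-mono-≤ n<m n<m)) h))

⌊n+n/2⌋≡n : ∀ n → ⌊ n + n /2⌋ ≡ n
⌊n+n/2⌋≡n n = sym (n≡⌊n+n/2⌋ n)

⌊1+n+n/2⌋≡n : ∀ n → ⌊ suc (n + n) /2⌋ ≡ n
⌊1+n+n/2⌋≡n zero    = refl
⌊1+n+n/2⌋≡n (suc n) = cong suc (trans (cong ⌊_/2⌋ (+-suc n n)) (⌊1+n+n/2⌋≡n n))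

1+n+n-odd : ∀ n → Oddℕ (suc (n + n))
1+n+n-odd n = cong (λ h → suc (h + h)) (sym (⌊1+n+n/2⌋≡n n))

¬n+n-odd : ∀ n → ¬ Oddℕ (n + n)
¬n+n-odd n odd = 1+n≢n (sym (trans odd (cong (λ h → suc (h + h)) (⌊n+n/2⌋≡n n))))

-- When ν is empty, nth ν 0 is 0 and the first test fails.
toggle : List ℕ → List ℕ → List ℕ × List ℕ
toggle []      []      = [] , []
toggle []      (p ∷ ν) = p + p ∷ [] , ν
toggle (x ∷ μ) ν       =
  decide (x <? nth ν 0 + nth ν 0) (nth ν 0 + nth ν 0 ∷ x ∷ μ , drop 1 ν)
    (decide (x ≟ ⌊ x /2⌋ + ⌊ x /2⌋) (μ , ⌊ x /2⌋ ∷ ν) (map₁ (x ∷_) (toggle μ ν)))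

-- The graph of toggle on valid arguments; its evident symmetry is the reason why toggle is an
-- involution.
data Toggle : (μ ν μ′ ν′ : List ℕ) → Set where
  fixed  : Toggle [] [] [] []
  insert : ∀ {p μ ν} → nth μ 0 < p + p → nth ν 0 ≤ p → Toggle μ (p ∷ ν) (p + p ∷ μ) ν
  remove : ∀ {p μ ν} → nth μ 0 < p + p → nth ν 0 ≤ p → Toggle (p + p ∷ μ) ν μ (p ∷ ν)
  skip   : ∀ {h μ ν μ′ ν′} → nth μ 0 < suc (h + h) → nth ν 0 ≤ h →
           nth μ′ 0 < suc (h + h) → nth ν′ 0 ≤ h →
           Toggle μ ν μ′ ν′ → Toggle (suc (h + h) ∷ μ) ν (suc (h + h) ∷ μ′) ν′

Toggle-sym : ∀ {μ ν μ′ ν′} → Toggle μ ν μ′ ν′ → Toggle μ′ ν′ μ ν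
Toggle-sym fixed              = fixed
Toggle-sym (insert h k)       = remove h k
Toggle-sym (remove h k)       = insert h k
Toggle-sym (skip a b a′ b′ t) = skip a′ b′ a b (Toggle-sym t)

-- The bounds say that the parts of `μ` and the doubled parts of `ν` stay below `2h + 1`, and an
-- exchange does not change this combined collection. They supply the conditions of `skip` on its
-- result.
Toggle-bounds : ∀ {h μ ν μ′ ν′} → Toggle μ ν μ′ ν′ → nth μ 0 < suc (h + h) → nth ν 0 ≤ h →
                nth μ′ 0 < suc (h + h) × nth ν′ 0 ≤ h
Toggle-bounds fixed            a b = a , b
Toggle-bounds (insert _ k)     a b = s≤s (+-mono-≤ b b) , ≤-trans k b
Toggle-bounds (remove k _)     a b = <-trans k a , half-≤ (<⇒≤ a)
Toggle-bounds (skip _ _ _ k _) a b = a , ≤-trans k (half-≤ (≤-trans (n≤1+n _) (<⇒≤ a)))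

-- Each failed test of `toggle` yields a side condition: the first gives `2ν₁ ≤ x`, which is halved,
-- and the second makes `x` odd.
Toggle-sound : ∀ μ ν → Valid (μ , ν) → Toggle μ ν (proj₁ (toggle μ ν)) (proj₂ (toggle μ ν))
Toggle-sound [] []      _ = fixed
Toggle-sound [] (p ∷ ν) (valid _ _ w (q ∷ _)) = insert (≤-trans q (m≤m+n p p)) (decreasing-head w)
Toggle-sound (x ∷ μ) ν v with x <? nth ν 0 + nth ν 0
Toggle-sound (x ∷ μ) (p ∷ ν) (valid _ _ w _) | yes x<2p = insert x<2p (decreasing-head w)
Toggle-sound (x ∷ μ) ν (valid s (p ∷ ps) w qs) | no x≮ with x ≟ ⌊ x /2⌋ + ⌊ x /2⌋
... | yes eq = subst (λ y → Toggle (y ∷ μ) ν μ (⌊ x /2⌋ ∷ ν)) (sym eq) (remove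
  (subst (nth μ 0 <_) eq (strict-head p s))
  (half-≤ {n = ⌊ x /2⌋} (≤-trans (≮⇒≥ x≮) (≤-trans (≤-reflexive eq) (n≤1+n _)))))
... | no neq with ⌊/2⌋-cases x
...   | inj₁ eq = contradiction eq neq
...   | inj₂ eq = subst (λ y → Toggle (y ∷ μ) ν (y ∷ proj₁ (toggle μ ν)) (proj₂ (toggle μ ν)))
  (sym eq) (skip a b (proj₁ ab′) (proj₂ ab′) t)
  where
  t = Toggle-sound μ ν (valid (Linked.tail s) ps w qs)
  a = subst (nth μ 0 <_) eq (strict-head p s)
  b = half-≤ {n = ⌊ x /2⌋} (≤-trans (≮⇒≥ x≮) (≤-reflexive eq))
  ab′ = Toggle-bounds t a b

-- The side conditions in the graph settle the tests of `toggle`. Combined with `Toggle-sym`, this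
-- shows that toggling twice returns the original pair.
Toggle⇒toggle : ∀ {μ ν μ′ ν′} → Toggle μ ν μ′ ν′ → toggle μ ν ≡ (μ′ , ν′)
Toggle⇒toggle fixed                      = refl
Toggle⇒toggle (insert {μ = []}    h k)   = refl
Toggle⇒toggle (insert {p} {x ∷ μ} h k)   = decide-yes (x <? p + p) h
Toggle⇒toggle (remove {p} {μ} {ν} h k)   = trans
  (decide-no (p + p <? nth ν 0 + nth ν 0) (≤⇒≯ (+-mono-≤ k k)))
  (trans (decide-yes (p + p ≟ _) (cong (λ q → q + q) (n≡⌊n+n/2⌋ p)))
         (cong (λ q → μ , q ∷ ν) (⌊n+n/2⌋≡n p)))
Toggle⇒toggle (skip {h} {μ} {ν} _ b _ _ t) = trans
  (decide-no (suc (h + h) <? nth ν 0 + nth ν 0) (≤⇒≯ (≤-trans (+-mono-≤ b b) (n≤1+n _))))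
  (trans (decide-no (suc (h + h) ≟ _) λ eq → 1+n≢n (trans eq (cong (λ q → q + q) (⌊1+n+n/2⌋≡n h))))
         (cong (map₁ (suc (h + h) ∷_)) (Toggle⇒toggle t)))

Toggle-valid : ∀ {μ ν μ′ ν′} → Toggle μ ν μ′ ν′ → Valid (μ , ν) → Valid (μ′ , ν′)
Toggle-valid fixed              v                         = v
Toggle-valid (insert h _)       (valid s ps w (q ∷ qs))   =
  valid (strict-∷ h s) (≤-trans (s≤s z≤n) h ∷ ps) (Linked.tail w) qs
Toggle-valid (remove {p} h k)   (valid s (_ ∷ ps) w qs)   =
  valid (Linked.tail s) ps (decreasing-∷ k w) (half-≤ (s≤s (≤-trans (s≤s z≤n) h)) ∷ qs)
Toggle-valid (skip _ _ a′ _ t)  (valid s (p ∷ ps) w qs)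
  with Toggle-valid t (valid (Linked.tail s) ps w qs)
... | valid s′ ps′ w′ qs′ = valid (strict-∷ a′ s′) (p ∷ ps′) w′ qs′

size-insert : ∀ p m n → m + ((p + n) + (p + n)) ≡ ((p + p) + m) + (n + n)
size-insert = ℕ-solve-∀

Toggle-size : ∀ {μ ν μ′ ν′} → Toggle μ ν μ′ ν′ → size (μ′ , ν′) ≡ size (μ , ν)
Toggle-size fixed                    = refl
Toggle-size (insert {p} {μ} {ν} _ _) = sym (size-insert p (sum μ) (sum ν))
Toggle-size (remove {p} {μ} {ν} _ _) = size-insert p (sum μ) (sum ν)
Toggle-size (skip {h} {μ} {ν} {μ′} {ν′} _ _ _ _ t) = trans (+-assoc x (sum μ′) (sum ν′ + sum ν′))
  (trans (cong (x ℕ.+_) (Toggle-size t)) (sym (+-assoc x (sum μ) (sum ν + sum ν))))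
  where x = suc (h + h)

-- Signs and fixed points of the exchange

Rigid : List ℕ × List ℕ → Set
Rigid (μ , ν) = ν ≡ [] × All Oddℕ μ

rigid? : Decidable Rigid
rigid? (μ , ν) = ≡-dec _≟_ ν [] ×-dec All.all? (λ n → n ≟ suc (⌊ n /2⌋ + ⌊ n /2⌋)) μ

pairSign : List ℕ → ℤ
pairSign ν = sign (length ν)

-- An insertion or removal changes the length of `ν` by one, and skipped odd parts do not touch it;
-- only a run of skips ending in `fixed` escapes cancellation.
Toggle-sign : ∀ {μ ν μ′ ν′} → Toggle μ ν μ′ ν′ →
              (Rigid (μ , ν) × ν′ ≡ []) ⊎ (¬ Rigid (μ , ν) × pairSign ν ℤ.+ pairSign ν′ ≡ 0ℤ)
Toggle-sign fixed = inj₁ ((refl , []) , refl)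
Toggle-sign (insert {ν = ν} _ _) = inj₂ ((λ ()) ,
  trans (cong (ℤ._+ pairSign ν) (sign-suc (length ν))) (ℤ.+-inverseˡ (pairSign ν)))
Toggle-sign (remove {p} {ν = ν} _ _) = inj₂ ((λ { (_ , odd ∷ _) → ¬n+n-odd p odd }) ,
  trans (cong (ℤ._+_ (pairSign ν)) (sign-suc (length ν))) (ℤ.+-inverseʳ (pairSign ν)))
Toggle-sign (skip {h} _ _ _ _ t) with Toggle-sign t
... | inj₁ ((eq , odds) , eq′) = inj₁ ((eq , 1+n+n-odd h ∷ odds) , eq′)
... | inj₂ (¬rigid , cancel)   = inj₂ ((λ { (eq , _ ∷ odds) → ¬rigid (eq , odds) }) , cancel)

∑-pairSign : ∀ n → ∑ (pairSign ∘ proj₂) (splittings n) ≡ + length (filter rigid? (splittings n))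
∑-pairSign n = trans
  (∑-signReversing (pairSign ∘ proj₂) (indicator ∘ rigid?) f (splittings-unique n) into inv cancel)
  (∑-indicator rigid? (splittings n))
  where
  f : List ℕ × List ℕ → List ℕ × List ℕ
  f (μ , ν) = toggle μ ν
  graph : ∀ {μν} → μν ∈ splittings n →
          Toggle (proj₁ μν) (proj₂ μν) (proj₁ (f μν)) (proj₂ (f μν))
  graph {μ , ν} μν∈ = Toggle-sound μ ν (proj₁ (splittings-sound n μν∈))
  into : ∀ {μν} → μν ∈ splittings n → f μν ∈ splittings n
  into μν∈ with splittings-sound n μν∈
  ... | v , sz = splittings-complete n (Toggle-valid (graph μν∈) v)
                                       (trans (Toggle-size (graph μν∈)) sz)
  inv : ∀ {μν} → μν ∈ splittings n → f (f μν) ≡ μν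
  inv μν∈ = Toggle⇒toggle (Toggle-sym (graph μν∈))
  cancel : ∀ {μν} → μν ∈ splittings n →
           pairSign (proj₂ μν) ℤ.+ pairSign (proj₂ (f μν)) ≡ + 2 * indicator (rigid? μν)
  cancel {μν} μν∈ with rigid? μν | Toggle-sign (graph μν∈)
  -- Both second components are empty, so the two signs add up to 1 + 1, twice the indicator.
  ... | yes _      | inj₁ ((eq , _) , eq′) = cong₂ (λ ν ν′ → pairSign ν ℤ.+ pairSign ν′) eq eq′
  ... | yes rigid  | inj₂ (¬rigid , _)     = contradiction rigid ¬rigid
  ... | no ¬rigid  | inj₁ (rigid , _)      = contradiction rigid ¬rigid
  ... | no _       | inj₂ (_ , eq)         = eq

-- Self-conjugate partitions and their diagonal hooks

-- The diagram `xs` with a new first column in front, reaching `k` rows below it.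
border : List ℕ → ℕ → List ℕ
border xs k = map suc xs ++ replicate k 1

length-border : ∀ xs k → length (border xs k) ≡ length xs + k
length-border []       k = length-replicate k
length-border (x ∷ xs) k = cong suc (length-border xs k)

sum-border : ∀ xs k → sum (border xs k) ≡ sum xs + length (border xs k)
sum-border []       zero    = refl
sum-border []       (suc k) = cong suc (sum-border [] k)
sum-border (x ∷ xs) k       = cong suc (begin
  x + sum (border xs k)                    ≡⟨ cong (x ℕ.+_) (sum-border xs k) ⟩
  x + (sum xs + length (border xs k))      ≡⟨ +-assoc x _ _ ⟨
  x + sum xs + length (border xs k)        ∎)
  ⟨ trans ⟩ sym (+-suc (x + sum xs) _)
  where open ≡-Reasoning

border-positive : ∀ xs k → All (1 ≤_) (border xs k)
border-positive []       zero    = []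
border-positive []       (suc k) = s≤s z≤n ∷ border-positive [] k
border-positive (x ∷ xs) k       = s≤s z≤n ∷ border-positive xs k

head-border : ∀ xs k → nth (border xs k) 0 ≤ suc (nth xs 0)
head-border []       zero    = z≤n
head-border []       (suc k) = ≤-refl
head-border (x ∷ xs) k       = ≤-refl

border-decreasing : ∀ {xs} → Decreasing xs → ∀ k → Decreasing (border xs k)
border-decreasing {[]}     d zero    = []
border-decreasing {[]}     d (suc k) = decreasing-∷ (head-border [] k) (border-decreasing d k)
border-decreasing {x ∷ xs} d k       = decreasing-∷
  (≤-trans (head-border xs k) (s≤s (decreasing-head d))) (border-decreasing (Linked.tail d) k)

-- Truncated subtraction sends both the added rows of length 1 and the default 0 past the end to 0,
-- so one formula serves every `i`.
nth-border : ∀ xs k i → nth (border xs k) i ∸ 1 ≡ nth xs i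
nth-border []       zero    i       = refl
nth-border []       (suc k) zero    = refl
nth-border []       (suc k) (suc i) = nth-border [] k i
nth-border (x ∷ xs) k       zero    = refl
nth-border (x ∷ xs) k       (suc i) = nth-border xs k i

-- Deletes the first column. In a decreasing list of positive parts the rows of length 1 come last,
-- so the recursion may stop at the first of them.
core : List ℕ → List ℕ
core (suc (suc y) ∷ ys) = suc y ∷ core ys
core _                  = []

core-border : ∀ {xs} → All (1 ≤_) xs → ∀ k → core (border xs k) ≡ xs
core-border []             zero    = refl
core-border []             (suc k) = refl
core-border (s≤s z≤n ∷ ps) k       = cong (_ ∷_) (core-border ps k)

length-core : ∀ ys → length (core ys) ≤ length ys
length-core []                 = z≤n
length-core (zero ∷ ys)        = z≤n
length-core (suc zero ∷ ys)    = z≤n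
length-core (suc (suc y) ∷ ys) = s≤s (length-core ys)

head-core : ∀ ys → nth (core ys) 0 ≤ nth ys 0 ∸ 1
head-core []                 = z≤n
head-core (zero ∷ ys)        = z≤n
head-core (suc zero ∷ ys)    = z≤n
head-core (suc (suc y) ∷ ys) = ≤-refl

core-decreasing : ∀ {ys} → Decreasing ys → Decreasing (core ys)
core-decreasing {[]}               d = []
core-decreasing {zero ∷ ys}        d = []
core-decreasing {suc zero ∷ ys}    d = []
core-decreasing {suc (suc y) ∷ ys} d = decreasing-∷
  (≤-trans (head-core ys) (∸-monoˡ-≤ 1 (decreasing-head d))) (core-decreasing (Linked.tail d))

core-positive : ∀ ys → All (1 ≤_) (core ys)
core-positive []                 = []
core-positive (zero ∷ ys)        = []
core-positive (suc zero ∷ ys)    = []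
core-positive (suc (suc y) ∷ ys) = s≤s z≤n ∷ core-positive ys

ones : ∀ {ys} → nth ys 0 ≤ 1 → Decreasing ys → All (1 ≤_) ys → ys ≡ replicate (length ys) 1
ones {[]}     _   _ _        = refl
ones {y ∷ ys} y≤1 d (p ∷ ps) = cong₂ _∷_ (≤-antisym y≤1 p)
  (ones (≤-trans (decreasing-head d) y≤1) (Linked.tail d) ps)

-- The rows lost in `core` are exactly the final ones, and the difference of lengths counts them.
border-core : ∀ {ys} → Decreasing ys → All (1 ≤_) ys →
              border (core ys) (length ys ∸ length (core ys)) ≡ ys
border-core {[]}               d ps       = refl
border-core {zero ∷ ys}        d (() ∷ _)
border-core {suc zero ∷ ys}    d ps       = sym (ones ≤-refl d ps)
border-core {suc (suc y) ∷ ys} d (_ ∷ ps) = cong (suc (suc y) ∷_) (border-core (Linked.tail d) ps)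

nth-core : ∀ {ys} → Decreasing ys → All (1 ≤_) ys → ∀ i → nth (core ys) i ≡ nth ys i ∸ 1
nth-core {ys} d ps i = trans (sym (nth-border (core ys) k i))
  (cong (λ zs → nth zs i ∸ 1) (border-core d ps))
  where k = length ys ∸ length (core ys)

Symmetric : List ℕ → Set
Symmetric xs = ∀ {i j} → j < nth xs i → i < nth xs j

nth-positive : ∀ {xs} → All (1 ≤_) xs → ∀ {i} → i < length xs → 0 < nth xs i
nth-positive (p ∷ ps) {zero}  _       = p
nth-positive (p ∷ ps) {suc i} (s≤s h) = nth-positive ps h

symmetric-length : ∀ {xs} → All (1 ≤_) xs → Symmetric xs → length xs ≡ nth xs 0
symmetric-length {xs} ps symm = <-ext
  (λ j j< → symm (nth-positive ps j<))
  (λ j j< → 0<nth⇒<length xs (symm j<))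

-- For `length xs ≤ h` the number of added ones makes the first column as long as the first row, so
-- the hook around `xs` has `2h + 1` cells.
hook : ℕ → List ℕ → List ℕ
hook h xs = suc h ∷ border xs (h ∸ length xs)

length-hook : ∀ {h} xs → length xs ≤ h → length (border xs (h ∸ length xs)) ≡ h
length-hook {h} xs l≤h = trans (length-border xs _) (m+[n∸m]≡n l≤h)

pred-< : ∀ {j m n} → m ∸ 1 ≡ n → suc j < m → j < n
pred-< {m = suc m} refl (s≤s h) = h

suc-< : ∀ {j m n} → m ∸ 1 ≡ n → j < n → suc j < m
suc-< {m = suc m} refl h = s≤s h

-- Transposition fixes the corner, exchanges the rest of the first row with that of the first
-- column, and acts on the remaining cells as on `xs` shifted along the diagonal.
hook-symmetric : ∀ {h} xs → length xs ≤ h → Symmetric xs → Symmetric (hook h xs)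
hook-symmetric     xs l≤h symm {zero}  {zero}  _        = s≤s z≤n
hook-symmetric {h} xs l≤h symm {zero}  {suc j} (s≤s j<) =
  nth-positive (border-positive xs _) (subst (j <_) (sym (length-hook xs l≤h)) j<)
hook-symmetric {h} xs l≤h symm {suc i} {zero}  0<       =
  s≤s (subst (i <_) (length-hook xs l≤h) (0<nth⇒<length (border xs _) 0<))
hook-symmetric {h} xs l≤h symm {suc i} {suc j} j<       =
  suc-< (nth-border xs _ j) (symm (pred-< (nth-border xs _ i) j<))

symmetric-tail : ∀ {h ys} → All (1 ≤_) (suc h ∷ ys) → Symmetric (suc h ∷ ys) → length ys ≡ h
symmetric-tail ps symm = suc-injective (symmetric-length ps symm)

core-symmetric : ∀ {x ys} → Decreasing ys → All (1 ≤_) ys → Symmetric (x ∷ ys) → Symmetric (core ys)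
core-symmetric d ps symm {i} {j} j< =
  pred-< (sym (nth-core d ps j)) (symm {suc i} {suc j} (suc-< (sym (nth-core d ps i)) j<))

hooks : List ℕ → List ℕ
hooks []      = []
hooks (x ∷ μ) = hook ⌊ x /2⌋ (hooks μ)

hooks-positive : ∀ μ → All (1 ≤_) (hooks μ)
hooks-positive []      = []
hooks-positive (x ∷ μ) = s≤s z≤n ∷ border-positive (hooks μ) _

double-< : ∀ {m n} → suc (m + m) < suc (n + n) → m < n
double-< {m} {n} h = half-≤ (≤-trans (≤-reflexive (cong suc (+-suc m m))) h)

-- Ensures that nested hooks fit: an inner hook with arm `h′ < h` has a first row of `h′ + 1` cells,
-- at most `h`.
head-hooks : ∀ {h μ} → All Oddℕ μ → nth μ 0 < suc (h + h) → nth (hooks μ) 0 ≤ h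
head-hooks []          _  = z≤n
head-hooks {h} (odd ∷ _) x< = double-< (subst (_< suc (h + h)) odd x<)

record HooksOf (μ : List ℕ) : Set where
  constructor hooksOf
  field
    isDecreasing : Decreasing (hooks μ)
    isSymmetric  : Symmetric (hooks μ)
    sum≡sum      : sum (hooks μ) ≡ sum μ

hooks-properties : ∀ {μ} → Strict μ → All Oddℕ μ → HooksOf μ
hooks-properties {[]}    s []           = hooksOf [] (λ ()) refl
hooks-properties {x ∷ μ} s (odd ∷ odds) with hooks-properties (Linked.tail s) odds
... | hooksOf d symm sum≡ = hooksOf
  (decreasing-∷ (≤-trans (head-border xs _) (s≤s head≤)) (border-decreasing d _))
  (hook-symmetric xs length≤ symm)
  (begin
    suc (h + sum (border xs k))               ≡⟨ cong (λ m → suc (h + m)) (sum-border xs k) ⟩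
    suc (h + (sum xs + length (border xs k))) ≡⟨ cong₂ (λ a b → suc (h + (a + b))) sum≡ (length-hook xs length≤) ⟩
    suc (h + (sum μ + h))                     ≡⟨ cong (λ m → suc (h + m)) (+-comm (sum μ) h) ⟩
    suc (h + (h + sum μ))                     ≡⟨ cong suc (+-assoc h h (sum μ)) ⟨
    suc (h + h) + sum μ                       ≡⟨ cong (_+ sum μ) odd ⟨
    x + sum μ                                 ∎)
  where
  open ≡-Reasoning
  xs = hooks μ
  h = ⌊ x /2⌋
  k = h ∸ length xs
  head≤ : nth xs 0 ≤ h
  head≤ = head-hooks odds (subst (nth μ 0 <_) odd (strict-head (subst (1 ≤_) (sym odd) (s≤s z≤n)) s))
  length≤ : length xs ≤ h
  length≤ = subst (_≤ h) (sym (symmetric-length (hooks-positive μ) symm)) head≤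

-- The first row determines `h` and so the odd part `suc (h + h)`; applying `core` to the rows below
-- recovers the inner hooks.
hooks-injective : ∀ {μ μ′} → All Oddℕ μ → All Oddℕ μ′ → hooks μ ≡ hooks μ′ → μ ≡ μ′
hooks-injective []           []             _  = refl
hooks-injective {x ∷ μ} {x′ ∷ μ′} (odd ∷ odds) (odd′ ∷ odds′) eq with ∷-injective eq
... | heads , tails = cong₂ _∷_
  (trans odd (trans (cong (λ h → suc (h + h)) (suc-injective heads)) (sym odd′)))
  (hooks-injective odds odds′ (trans (sym (core-border (hooks-positive μ) _))
    (trans (cong core tails) (core-border (hooks-positive μ′) _))))

record FromHooks (xs : List ℕ) : Set where
  constructor fromHooks
  field
    {lengths} : List ℕ
    isStrict  : Strict lengths
    isOdd     : All Oddℕ lengths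
    hooks≡    : hooks lengths ≡ xs

-- The outermost hook is peeled off, and what remains is again symmetric. The bound `n` on the
-- number of rows drives the recursion, as `core ys` is not a subterm of the input.
hooks-surjective : ∀ n {xs} → length xs ≤ n → Decreasing xs → All (1 ≤_) xs → Symmetric xs →
                   FromHooks xs
hooks-surjective n       {[]}         _         _ _        _    = fromHooks [] [] refl
hooks-surjective (suc n) {suc h ∷ ys} (s≤s l≤n) d (p ∷ ps) symm
  with hooks-surjective n (≤-trans (length-core ys) l≤n) (core-decreasing (Linked.tail d))
         (core-positive ys) (core-symmetric (Linked.tail d) ps symm)
... | fromHooks {μ} s odds eq = fromHooks
  (strict-∷ (bound μ odds (≤-trans (≤-reflexive (cong (λ zs → nth zs 0) eq)) core≤)) s)
  (1+n+n-odd h ∷ odds)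
  (begin
    hook ⌊ suc (h + h) /2⌋ (hooks μ)     ≡⟨ cong₂ hook (⌊1+n+n/2⌋≡n h) eq ⟩
    -- By symmetry `ys` has `h` rows, so the ones put back are those that `core` removed.
    suc h ∷ border c (h ∸ length c)      ≡⟨ cong (λ l → suc h ∷ border c (l ∸ length c)) (symmetric-tail (p ∷ ps) symm) ⟨
    suc h ∷ border c (length ys ∸ length c) ≡⟨ cong (suc h ∷_) (border-core (Linked.tail d) ps) ⟩
    suc h ∷ ys                           ∎)
  where
  open ≡-Reasoning
  c = core ys
  core≤ : nth c 0 ≤ h
  core≤ = ≤-trans (head-core ys) (∸-monoˡ-≤ 1 (decreasing-head d))
  -- Strictness of the new list: the inner first row is one longer than its arm and has at most `h`
  -- cells, so that arm is below `h`.
  bound : ∀ μ → All Oddℕ μ → nth (hooks μ) 0 ≤ h → nth μ 0 < suc (h + h)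
  bound []      _         _ = s≤s z≤n
  bound (x ∷ μ) (odd ∷ _) a<h = subst (_< suc (h + h)) (sym odd) (s≤s (+-mono-< a<h a<h))

odd-positive : ∀ {n} → Oddℕ n → 1 ≤ n
odd-positive odd = subst (1 ≤_) (sym odd) (s≤s z≤n)

-- Rigid pairs and partitions without diagonal blocks in bijection

rigids : ℕ → List (List ℕ × List ℕ)
rigids n = filter rigid? (splittings n)

κ≡0? : Decidable (λ μ → κ μ ≡ 0)
κ≡0? μ = κ μ ≟ 0

blockless : ℕ → List Partition
blockless n = filter κ≡0? (partitions n)

rigids-sound : ∀ n {μν} → μν ∈ rigids n → (Valid μν × size μν ≡ n) × Rigid μν
rigids-sound n μν∈ = map₁ (splittings-sound n) (∈-filter⁻ rigid? {xs = splittings n} μν∈)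

rigids-complete : ∀ n {μν} → Valid μν → size μν ≡ n → Rigid μν → μν ∈ rigids n
rigids-complete n v size≡n rigid = ∈-filter⁺ rigid? (splittings-complete n v size≡n) rigid

blockless-sound : ∀ n {π} → π ∈ blockless n → π ⊢ n × Symmetric (parts π)
blockless-sound n {π} π∈ = partitions-sound n (proj₁ π∈′) ,
  λ {i} {j} → selfConjugate-⇒ π (κ≡0⇒selfConjugate π (proj₂ π∈′)) {j} {i}
  where π∈′ = ∈-filter⁻ κ≡0? {xs = partitions n} π∈

blockless-complete : ∀ n {π} → π ⊢ n → Symmetric (parts π) → π ∈ blockless n
blockless-complete n {π} π⊢n symm = ∈-filter⁺ κ≡0? (partitions-complete n {π} π⊢n)
  (selfConjugate⇒κ≡0 π (selfConjugate-⇐ π (λ {i} {j} → symm {j} {i})))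

hooks-into : ∀ n {μν} → (Valid μν × size μν ≡ n) × Rigid μν →
             hooks (proj₁ μν) ∈ map parts (blockless n)
hooks-into n {μ , _} ((valid s _ _ _ , size≡n) , refl , odds) =
  ∈-map⁺ parts (blockless-complete n {partition (hooks μ) isDecreasing (hooks-positive μ)}
    (trans sum≡sum (trans (sym (+-identityʳ (sum μ))) size≡n)) isSymmetric)
  where open HooksOf (hooks-properties s odds)

hooks-onto : ∀ n {π} → π ⊢ n × Symmetric (parts π) →
             ∃ λ μν → μν ∈ rigids n × hooks (proj₁ μν) ≡ parts π
hooks-onto n {π} (π⊢n , symm) = (lengths , []) ,
  rigids-complete n (valid isStrict (All.map odd-positive isOdd) [] []) (begin
    sum lengths + 0      ≡⟨ +-identityʳ (sum lengths) ⟩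
    sum lengths          ≡⟨ HooksOf.sum≡sum (hooks-properties isStrict isOdd) ⟨
    sum (hooks lengths)  ≡⟨ cong sum hooks≡ ⟩
    sum (parts π)        ≡⟨ π⊢n ⟩
    n                    ∎) (refl , isOdd) ,
  hooks≡
  where
  open ≡-Reasoning
  open FromHooks (hooks-surjective _ ≤-refl (decreasing π) (positive π) symm)

hooks-injective-rigid : ∀ {x y} → Rigid x → Rigid y → hooks (proj₁ x) ≡ hooks (proj₁ y) → x ≡ y
hooks-injective-rigid (refl , odds) (refl , odds′) eq = cong (_, []) (hooks-injective odds odds′ eq)

-- The comparison takes place among lists of parts, because the proofs that make `hooks μ` a
-- `Partition` depend on validity and rigidity.
rigid-count : ∀ n → length (rigids n) ≡ length (blockless n)
rigid-count n = begin
  length (rigids n)                        ≡⟨ length-map (hooks ∘ proj₁) (rigids n) ⟨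
  length (map (hooks ∘ proj₁) (rigids n))  ≡⟨ ↭-length (map-↭ (hooks ∘ proj₁)
    (Unique.filter⁺ rigid? (splittings-unique n))
    (Unique.map⁺ parts-injective (Unique.filter⁺ κ≡0? (partitions-unique n)))
    (λ x∈ → hooks-into n (rigids-sound n x∈))
    (λ x∈ y∈ → hooks-injective-rigid (proj₂ (rigids-sound n x∈)) (proj₂ (rigids-sound n y∈)))
    onto) ⟩
  length (map parts (blockless n))         ≡⟨ length-map parts (blockless n) ⟩
  length (blockless n)                     ∎
  where
  open ≡-Reasoning
  onto : ∀ {xs} → xs ∈ map parts (blockless n) → ∃ λ μν → μν ∈ rigids n × hooks (proj₁ μν) ≡ xs
  onto xs∈ =
    let π , π∈ , xs≡      = ∈-map⁻ parts {xs = blockless n} xs∈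
        μν , μν∈ , hooks≡ = hooks-onto n {π} (blockless-sound n {π} π∈)
    in μν , μν∈ , trans hooks≡ (sym xs≡)

-- The signed count and the final identity

signedCount : ∀ n → ∑ (sign ∘ r) (partitions n) ≡ + count (λ μ → κ μ ≟ 0) n
signedCount n = begin
  ∑ (sign ∘ r) (partitions n)
    ≡⟨ ∑-cong (partitions n) (λ {μ} _ → cong sign (r≡head-pairs μ)) ⟩
  ∑ (λ μ → sign (nth (pairs (parts μ)) 0)) (partitions n)
    ≡⟨ ∑-map (λ μν → sign (nth (proj₂ μν) 0)) (split ∘ parts) (partitions n) ⟨
  ∑ (λ μν → sign (nth (proj₂ μν) 0)) (splittings n)
    ≡⟨ ∑-conjugatePairs n ⟩
  ∑ (pairSign ∘ proj₂) (splittings n)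
    ≡⟨ ∑-pairSign n ⟩
  + length (filter rigid? (splittings n))
    ≡⟨ cong +_ (rigid-count n) ⟩
  + count (λ μ → κ μ ≟ 0) n ∎
  where open ≡-Reasoning

corollary4p4 : ((μ : Partition) → κ μ ≡ 0 ⇔ conjugate μ ≡ μ)
    × ((n : ℕ) → + E n - + O n ≡ -1ℤ ^ n * + count (λ μ → κ μ ≟ 0) n)
corollary4p4 = κ≡0⇔selfConjugate , λ n → begin
  + E n - + O n
    ≡⟨ even-odd-difference (∣_∣ ∘ ρ) (even? ∘ ρ) (partitions n) ⟩
  ∑ (sign ∘ ∣_∣ ∘ ρ) (partitions n)
    -- The parity of `s` contributes the same sign for all partitions of `n`, which leaves the sign
    -- of `r` under the sum.
    ≡⟨ ∑-cong (partitions n) (λ {μ} μ∈ → trans (sign-ρ μ)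
         (cong (λ k → sign k * sign (r μ)) (partitions-sound n μ∈))) ⟩
  ∑ (λ μ → sign n * sign (r μ)) (partitions n)
    ≡⟨ ∑-*ˡ (sign n) (sign ∘ r) (partitions n) ⟩
  sign n * ∑ (sign ∘ r) (partitions n)
    ≡⟨ cong (sign n *_) (signedCount n) ⟩
  -1ℤ ^ n * + count (λ μ → κ μ ≟ 0) n ∎
  where open ≡-Reasoning
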